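{- Let $p$ be a prime, let $k,r$ be positive integers with $k\ge 2$ and $r\le k$, let $h\ge r+2$ be an integer, and let $A$ be a $k$-element subset of $\mathbb{Z}_p$. If \[ |h^{(\geq r)}A| = h(k-1)-r(r-1)+1 \le p-2, \] then $A$ is an arithmetic progression in $\mathbb{Z}_p$.
   Context: $\mathbb{Z}_p=\{0,1,\ldots,p-1\}$ with addition modulo $p$. For a finite non-empty set $A=\{a_1,\ldots,a_k\}$ in an abelian group, a positive integer $r\le k$ and an integer $h\ge r$, define $h^{(\geq r)}A := \{ \sum_{i\in I} x_i a_i : I\subset\{1,\ldots,k\},\ |I|\ge r,\ x_i\ge 1 \text{ for all } i\in I,\ \sum_{i\in I}x_i = h\}$, i.e. the set of sums of $h$ elements of $A$ among which at least $r$ are distinct. -}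

module Defs where

open import Data.Nat using (ℕ; zero; suc; _+_; _*_; _∸_; _≤_; _<_; NonZero)
open import Data.Nat.DivMod using (_%_)
open import Data.Fin using (Fin; toℕ; fromℕ<)
open import Data.Fin.Properties using ()
open import Data.List using (List; length)
open import Data.List.Relation.Unary.Unique.Propositional using (Unique)
open import Data.List.Membership.Propositional using (_∈_)
open import Data.Product using (Σ; ∃; ∃-syntax; _×_; _,_)
open import Relation.Binary.PropositionalEquality using (_≡_; _≢_)
open import Function.Bundles using (_⇔_)
open import Function.Definitions using (Injective)

Σᶠ : (k : ℕ) → (Fin k → ℕ) → ℕ
Σᶠ zero    f = 0
Σᶠ (suc k) f = f Data.Fin.zero + Σᶠ k (λ i → f (Data.Fin.suc i))

supp : (k : ℕ) → (Fin k → ℕ) → ℕ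
supp zero    f = 0
supp (suc k) f with f Data.Fin.zero
... | zero  = supp k (λ i → f (Data.Fin.suc i))
... | suc _ = suc (supp k (λ i → f (Data.Fin.suc i)))

-- An element of ℤ_p = {0,…,p-1} is a natural number below p;
-- ℤ_p is represented by Fin p, with addition modulo p.
-- A k-element set A = {a_1,…,a_k} ⊆ ℤ_p is an injective map a : Fin k → Fin p.

InRestrictedSumset : (p : ℕ) .{{_ : NonZero p}} (k : ℕ) (a : Fin k → Fin p)
                     (h r : ℕ) → Fin p → Set
InRestrictedSumset p k a h r s =
  ∃[ x ] (Σᶠ k x ≡ h × r ≤ supp k x ×
          toℕ s ≡ Σᶠ k (λ i → x i * toℕ (a i)) % p)

HasCard : {p : ℕ} → (Fin p → Set) → ℕ → Set
HasCard {p} S n = ∃[ L ] (Unique L × length L ≡ n × (∀ s → (s ∈ L) ⇔ S s))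

IsAP : (p : ℕ) .{{_ : NonZero p}} (k : ℕ) (a : Fin k → Fin p) → Set
IsAP p k a = ∃[ c ] ∃[ d ] (∀ (s : Fin p) →
  (∃[ j ] s ≡ a j) ⇔ (∃[ i ] (i < k × toℕ s ≡ (c + i * d) % p)))

{-# OPTIONS --safe #-}
-- The set in question is X + A with X = r^A + (h - r - 1)A, where r^A is the set of sums
-- of r distinct elements of A. If |X| ≥ r(k - r) + (h - r - 1)(k - 1) + 1, the hypothesis
-- makes (X , A) an extremal pair for Cauchy–Davenport, and Vosper's theorem says that A is
-- a progression. By Cauchy–Davenport the bound on X follows from the
-- Dias da Silva–Hamidoune bound |r^A| ≥ r(k - r) + 1.
--
-- Dias da Silva–Hamidoune: if at most M = r(k - r) values c exhaust r^A, the product of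
-- the Vandermonde polynomial with all (x₁ + ⋯ + xᵣ - c) vanishes on Aʳ, hence its
-- coefficients in the Newton basis of A with all degrees below k vanish mod p. In top
-- degree these are the coefficients of Eᵐ V, where V is the Vandermonde polynomial and E
-- is multiplication by x₁ + ⋯ + xᵣ. Completing E to an sl₂-triple for which V is a lowest
-- weight vector gives F Eᵐ⁺¹ V = (m + 1)(M - m) Eᵐ V, so as M < p all coefficients of V
-- itself would vanish mod p, which is false.
--
-- Vosper follows Hamidoune's isoperimetric method: a minimal critical set X for B meets
-- its proper translates in at most one point; so does a minimal critical set Y for X, and
-- together this forces |X| = 2. Then |B ∪ (B + d)| = |B| + 1 makes B a progression.
module Submission where

open import Defs
open import Algebra.Bundles using (AbelianGroup)
import Algebra.Properties.AbelianGroup as AbelianGroupProperties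
open import Algebra.Structures using (IsAbelianGroup)
open import Data.Bool using (Bool; true; false; T; _∧_; _∨_; not; if_then_else_)
open import Data.Bool.Properties using (T?; T-∧; T-∨)
open import Data.Fin as Fin using (Fin; toℕ; fromℕ<)
open import Data.Fin.Permutation using (permutation)
import Data.Fin.Properties as Fin
open import Data.Integer as ℤ using (ℤ; 0ℤ; 1ℤ; ∣_∣)
open import Data.Integer.Divisibility.Signed as ℤ∣ using (∣ᵤ⇒∣; ∣⇒∣ᵤ) renaming (_∣_ to _∣ℤ_)
import Data.Integer.Properties as ℤ
import Data.Integer.Tactic.RingSolver as ℤ-Solver
open import Data.List as List using (List; []; _∷_; length)
import Data.List.Membership.Propositional as ListMembership
open import Data.List.Membership.Propositional.Properties using (∈-map⁺)
import Data.List.Properties as List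
open import Data.List.Relation.Unary.Any as ListAny using (here; there)
import Data.List.Relation.Unary.Any.Properties as ListAny
open import Data.Nat as ℕ using (ℕ; zero; suc; pred; s≤s; z≤n; _≤_; _<_; _≥_; NonZero)
open import Data.Nat.Coprimality using (prime⇒coprime; coprime-Bézout)
import Data.Nat.Divisibility as ℕ∣
open import Data.Nat.DivMod using (_%_; _/_; _mod_; m%n<n; m%n%n≡m%n; %-distribˡ-+; %-distribˡ-*; n%n≡0;
  [m+n]%n≡m%n; [m+kn]%n≡m%n; m<n⇒m%n≡m; m≡m%n+[m/n]*n)
open import Data.Nat.GCD using (module Bézout)
open import Data.Nat.Induction using (<-wellFounded)
open import Data.Nat.Primality using (Prime; euclidsLemma; prime⇒nonZero; prime⇒nonTrivial)
import Data.Nat.Properties as ℕ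
import Data.Nat.Tactic.RingSolver as ℕ-Solver
open import Data.Product using (_×_; _,_; ∃; ∃-syntax; proj₁; proj₂)
open import Data.Sum using (_⊎_; inj₁; inj₂; [_,_]′)
open import Data.Vec as Vec using (Vec; []; _∷_; sum)
open import Data.Vec.Relation.Unary.All as All using (All; []; _∷_)
open import Data.Vec.Relation.Unary.AllPairs as AllPairs using ([]; _∷_)
open import Data.Vec.Relation.Unary.Any using (Any; here; there; any?)
open import Data.Vec.Relation.Unary.Unique.Propositional using (Unique)
open import Function.Base using (_∘_)
open import Function.Bundles using (module Equivalence; _⇔_; mk⇔)
open import Function.Definitions using (Injective)
open import Induction.WellFounded using (Acc; acc)
open import Level using (0ℓ)
open import Relation.Binary.Definitions using (tri<; tri≈; tri>)
open import Relation.Binary.PropositionalEquality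
open import Relation.Nullary using (¬_; Dec; yes; no; contradiction; ¬?; _×-dec_; ⌊_⌋)
open import Relation.Nullary.Decidable using (toWitness; fromWitness; decidable-stable; map′)
open import Relation.Unary using (Decidable)

-- The action of sl₂ on tensors of integer coefficients.

module Tensors where

  open import Data.Integer using (+_; -_; _+_; _-_; _*_)
  open import Data.Integer.Tactic.RingSolver using (solve-∀)

  Tensor : ℕ → Set
  Tensor r = Vec ℕ r → ℤ

  infixr 5 _◂_
  _◂_ : ∀ {r} → ℕ → Tensor (suc r) → Tensor r
  (n ◂ g) u = g (n ∷ u)

  -- D lets the one-variable operator f ↦ (n ↦ c n * f (σ n)) act on each coordinate in
  -- turn and adds up the results, as a derivation does.
  D : ∀ {r} → (ℕ → ℤ) → (ℕ → ℕ) → Tensor r → Tensor r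
  D c σ g []      = 0ℤ
  D c σ g (n ∷ u) = c n * g (σ n ∷ u) + D c σ (n ◂ g) u

  module _ {c : ℕ → ℤ} {σ : ℕ → ℕ} where

    D-cong : ∀ {r} {f g : Tensor r} → (∀ u → f u ≡ g u) → ∀ u → D c σ f u ≡ D c σ g u
    D-cong eq []      = refl
    D-cong eq (n ∷ u) = cong₂ _+_ (cong (c n *_) (eq _)) (D-cong (λ w → eq (n ∷ w)) u)

    D-+ : ∀ {r} (f g : Tensor r) u → D c σ (λ w → f w + g w) u ≡ D c σ f u + D c σ g u
    D-+ f g []      = refl
    D-+ f g (n ∷ u) rewrite D-+ (n ◂ f) (n ◂ g) u =
      lem (c n) (f (σ n ∷ u)) (g (σ n ∷ u)) (D c σ (n ◂ f) u) (D c σ (n ◂ g) u)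
      where
      lem : ∀ a b b′ x y → a * (b + b′) + (x + y) ≡ a * b + x + (a * b′ + y)
      lem = solve-∀

    D-scale : ∀ {r} x (f : Tensor r) u → D c σ (λ w → x * f w) u ≡ x * D c σ f u
    D-scale x f []      = sym (ℤ.*-zeroʳ x)
    D-scale x f (n ∷ u) rewrite D-scale x (n ◂ f) u =
      lem (c n) (f (σ n ∷ u)) x (D c σ (n ◂ f) u)
      where
      lem : ∀ a b x y → a * (x * b) + x * y ≡ x * (a * b + y)
      lem = solve-∀

    D-linear : ∀ {r} x (f g : Tensor r) u → D c σ (λ w → x * f w + g w) u ≡ x * D c σ f u + D c σ g u
    D-linear x f g u = trans (D-+ _ g u) (cong (_+ D c σ g u) (D-scale x f u))

    D-zero : ∀ {r} {f : Tensor r} → (∀ u → f u ≡ 0ℤ) → ∀ u → D c σ f u ≡ 0ℤ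
    D-zero eq []      = refl
    D-zero eq (n ∷ u) rewrite eq (σ n ∷ u) | D-zero (λ w → eq (n ∷ w)) u =
      trans (ℤ.+-identityʳ _) (ℤ.*-zeroʳ (c n))

  δ : ℕ → ℤ
  δ zero    = 0ℤ
  δ (suc n) = 1ℤ

  -- Reading a tensor as the coefficients of a power series in x₁,…,xᵣ, E is
  -- multiplication by x₁ + ⋯ + xᵣ.
  E : ∀ {r} → Tensor r → Tensor r
  E = D δ pred

  E^ : ∀ {r} → ℕ → Tensor r → Tensor r
  E^ zero    g = g
  E^ (suc m) g = E (E^ m g)

  wt : ℕ → ℕ → ℤ
  wt K n = + suc n * (+ K - + n)

  -- E and F generate an action of sl₂ on the r-th tensor power of its irreducible
  -- representation of dimension K + 1; the weight wt K is normalised so that E needs none.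
  F : ∀ {r} → ℕ → Tensor r → Tensor r
  F K = D (wt K) suc

  -- Contributions of two different coordinates commute, so the commutator is a sum over the
  -- coordinates. On one coordinate with exponent n it is the scalar `wt K n` - n (K - n + 1) = K -
  -- 2n, and these add up to r K - 2 `sum u`.
  [F,E] : ∀ K {r} (g : Tensor r) u →
          F K (E g) u ≡ E (F K g) u + (+ r * + K - + 2 * + sum u) * g u
  [F,E] K g []              = refl
  [F,E] K {suc r} g (n ∷ u) = begin
    wt K n * (1ℤ * g (n ∷ u) + E (suc n ◂ g) u) + F K (λ w → δ n * g (pred n ∷ w) + E (n ◂ g) w) u
      ≡⟨ cong (λ x → wt K n * (1ℤ * g (n ∷ u) + E (suc n ◂ g) u) + x)
           (trans (D-linear (δ n) (pred n ◂ g) (E (n ◂ g)) u)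
             (cong (λ x → δ n * F K (pred n ◂ g) u + x) ([F,E] K (n ◂ g) u))) ⟩
    wt K n * (1ℤ * g (n ∷ u) + E (suc n ◂ g) u) + (δ n * F K (pred n ◂ g) u
      + (E (F K (n ◂ g)) u + (+ r * + K - + 2 * + sum u) * g (n ∷ u)))
      ≡⟨ site n ⟩
    δ n * (wt K (pred n) * g (suc (pred n) ∷ u) + F K (pred n ◂ g) u)
      + (wt K n * E (suc n ◂ g) u + E (F K (n ◂ g)) u) + H (+ n) (+ sum u) * g (n ∷ u)
      ≡⟨ cong₂ (λ x y → δ n * (wt K (pred n) * g (suc (pred n) ∷ u) + F K (pred n ◂ g) u) + x + y * g (n ∷ u))
           (sym (D-linear (wt K n) (suc n ◂ g) (F K (n ◂ g)) u)) H≡ ⟩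
    δ n * (wt K (pred n) * g (suc (pred n) ∷ u) + F K (pred n ◂ g) u)
      + E (λ w → wt K n * g (suc n ∷ w) + F K (n ◂ g) w) u
      + (+ suc r * + K - + 2 * + (n ℕ.+ sum u)) * g (n ∷ u) ∎
    where
    open ≡-Reasoning
    H : ℤ → ℤ → ℤ
    H x s = (1ℤ + + r) * + K - + 2 * (x + s)
    H≡ : H (+ n) (+ sum u) ≡ + suc r * + K - + 2 * + (n ℕ.+ sum u)
    H≡ = cong (λ x → x * + K - + 2 * + (n ℕ.+ sum u)) (sym (ℤ.pos-+ 1 r))
    -- `suc (pred n)` is n only for positive n; at n = 0 the factor `δ n` removes the terms that
    -- contain `pred n`. Each case is then a polynomial identity.
    site : ∀ n →
      wt K n * (1ℤ * g (n ∷ u) + E (suc n ◂ g) u) + (δ n * F K (pred n ◂ g) u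
        + (E (F K (n ◂ g)) u + (+ r * + K - + 2 * + sum u) * g (n ∷ u)))
      ≡ δ n * (wt K (pred n) * g (suc (pred n) ∷ u) + F K (pred n ◂ g) u)
        + (wt K n * E (suc n ◂ g) u + E (F K (n ◂ g)) u) + H (+ n) (+ sum u) * g (n ∷ u)
    site zero = lem (+ K) (+ r) (+ sum u) (g (zero ∷ u)) (E (1 ◂ g) u) (F K (0 ◂ g) u) (E (F K (0 ◂ g)) u) (g (1 ∷ u))
      where
      lem : ∀ K r s G X Y Z W →
        (+ 1 * (K - + 0)) * (+ 1 * G + X) + (+ 0 * Y + (Z + (r * K - + 2 * s) * G))
        ≡ + 0 * (+ 1 * (K - + 0) * W + Y) + ((+ 1 * (K - + 0)) * X + Z)
          + ((+ 1 + r) * K - + 2 * (+ 0 + s)) * G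
      lem = solve-∀
    site (suc n) = lem (+ K) (+ r) (+ sum u) (+ n) (g (suc n ∷ u)) (E (suc (suc n) ◂ g) u) (F K (n ◂ g) u) (E (F K (suc n ◂ g)) u)
      where
      lem : ∀ K r s n G X Y Z →
        ((+ 1 + (+ 1 + n)) * (K - (+ 1 + n))) * (+ 1 * G + X) + (+ 1 * Y + (Z + (r * K - + 2 * s) * G))
        ≡ + 1 * ((+ 1 + n) * (K - n) * G + Y) + ((+ 1 + (+ 1 + n)) * (K - (+ 1 + n)) * X + Z)
          + ((+ 1 + r) * K - + 2 * ((+ 1 + n) + s)) * G
      lem = solve-∀

  E-local : ∀ {r} {f g : Tensor r} u → (∀ w → suc (sum w) ≡ sum u → f w ≡ g w) → E f u ≡ E g u
  E-local []          eq = refl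
  E-local (zero ∷ u)  eq = cong (λ x → 0ℤ + x) (E-local u (λ w e → eq (0 ∷ w) e))
  E-local (suc n ∷ u) eq =
    cong₂ _+_ (cong (1ℤ *_) (eq (n ∷ u) refl))
      (E-local u (λ w e → eq (suc n ∷ w) (trans (cong suc (sym (ℕ.+-suc n (sum w)))) (cong (suc n ℕ.+_) e))))

  F-local : ∀ K {r} {f g : Tensor r} u → (∀ w → sum w ≡ suc (sum u) → f w ≡ g w) → F K f u ≡ F K g u
  F-local K []      eq = refl
  F-local K (n ∷ u) eq =
    cong₂ _+_ (cong (wt K n *_) (eq (suc n ∷ u) refl))
      (F-local K u (λ w e → eq (n ∷ w) (trans (cong (n ℕ.+_) e) (ℕ.+-suc n (sum u)))))

  Homogeneous : ∀ {r} → ℕ → Tensor r → Set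
  Homogeneous d g = ∀ u → sum u ≢ d → g u ≡ 0ℤ

  E-homogeneous : ∀ {r d} {g : Tensor r} → Homogeneous d g → Homogeneous (suc d) (E g)
  E-homogeneous hom u ≢d =
    trans (E-local u (λ w e → hom w (λ e′ → ≢d (trans (sym e) (cong suc e′))))) (D-zero (λ _ → refl) u)

  E^-homogeneous : ∀ {r d} {g : Tensor r} → Homogeneous d g → ∀ m → Homogeneous (m ℕ.+ d) (E^ m g)
  E^-homogeneous hom zero    = hom
  E^-homogeneous hom (suc m) = E-homogeneous (E^-homogeneous hom m)

  module _ {K r d M : ℕ} {g : Tensor r} (hom : Homogeneous d g) (Fg≡0 : ∀ u → F K g u ≡ 0ℤ)
           (weight : r ℕ.* K ≡ M ℕ.+ 2 ℕ.* d) where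

    -- Away from degree m + d both sides vanish by homogeneity. In degree m + d, `weight` turns r K
    -- - 2 (m + d) into M - 2m.
    E^-weight : ∀ m u → (+ r * + K - + 2 * + sum u) * E^ m g u ≡ (+ M - + 2 * + m) * E^ m g u
    E^-weight m u with sum u ℕ.≟ m ℕ.+ d
    ... | no ≢d  rewrite E^-homogeneous hom m u ≢d = trans (ℤ.*-zeroʳ (+ r * + K - + 2 * + sum u)) (sym (ℤ.*-zeroʳ (+ M - + 2 * + m)))
    ... | yes ≡d = cong (_* E^ m g u) (trans (cong₂ _-_ rK (cong (λ s → + 2 * + s) ≡d)) (lem (+ M) (+ d) (+ m)))
      where
      rK : + r * + K ≡ + M + + 2 * + d
      rK = trans (sym (ℤ.pos-* r K)) (trans (cong +_ weight) (cong (λ x → + M + x) (ℤ.pos-* 2 d)))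
      lem : ∀ M d m → M + + 2 * d - + 2 * (m + d) ≡ M - + 2 * m
      lem = solve-∀

    -- Moving `F` past the factors `E` one by one collects the weights M, M - 2, ..., M - 2m, whose
    -- sum is (m + 1)(M - m); the term that remains contains `F K g`, which is 0.
    F-E^ : ∀ m u → F K (E^ (suc m) g) u ≡ + suc m * (+ M - + m) * E^ m g u
    F-E^ m u = begin
      F K (E (E^ m g)) u ≡⟨ [F,E] K (E^ m g) u ⟩
      E (F K (E^ m g)) u + (+ r * + K - + 2 * + sum u) * E^ m g u
        ≡⟨ cong₂ _+_ (EF m) (E^-weight m u) ⟩
      + m * (+ M - + m + 1ℤ) * E^ m g u + (+ M - + 2 * + m) * E^ m g u
        ≡⟨ lem (+ M) (+ m) (E^ m g u) ⟩
      + suc m * (+ M - + m) * E^ m g u ∎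
      where
      open ≡-Reasoning
      lem : ∀ M m x → m * (M - m + + 1) * x + (M - + 2 * m) * x ≡ (+ 1 + m) * (M - m) * x
      lem = solve-∀
      EF : ∀ m → E (F K (E^ m g)) u ≡ + m * (+ M - + m + 1ℤ) * E^ m g u
      EF zero    = trans (D-zero Fg≡0 u) (lem₀ (+ M) (g u))
        where
        lem₀ : ∀ M x → + 0 ≡ + 0 * (M - + 0 + + 1) * x
        lem₀ = solve-∀
      EF (suc m) = trans (D-cong (F-E^ m) u) (trans (D-scale (+ suc m * (+ M - + m)) (E^ m g) u) (cong (_* E^ (suc m) g u) (lem₁ (+ M) (+ m))))
        where
        lem₁ : ∀ M m → (+ 1 + m) * (M - m) ≡ (+ 1 + m) * (M - (+ 1 + m) + + 1)
        lem₁ = solve-∀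

  -- Divisibility by p and the descent from `E^ m g` to `g`.

  euclidℤ : ∀ {p} → Prime p → ∀ x y → + p ∣ℤ x * y → + p ∣ℤ x ⊎ + p ∣ℤ y
  euclidℤ pr x y d with euclidsLemma ∣ x ∣ ∣ y ∣ pr (subst (_ ℕ∣.∣_) (ℤ.abs-* x y) (∣⇒∣ᵤ d))
  ... | inj₁ e = inj₁ (∣ᵤ⇒∣ e)
  ... | inj₂ e = inj₂ (∣ᵤ⇒∣ e)

  small-∤ : ∀ {p n} → 0 < n → n < p → ¬ + p ∣ℤ + n
  small-∤ 0<n n<p d = ℕ.<⇒≱ n<p (ℕ∣.∣⇒≤ {{ℕ.>-nonZero 0<n}} (∣⇒∣ᵤ d))

  DivisibleOnBox : ∀ {r} → ℕ → ℕ → Tensor r → Set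
  DivisibleOnBox k p g = ∀ u → All (_< k) u → + p ∣ℤ g u

  -- wt K vanishes at K, so F does not reach outside the box from inside.
  F-divisible : ∀ K {p r} {g : Tensor r} → DivisibleOnBox (suc K) p g → DivisibleOnBox (suc K) p (F K g)
  F-divisible K dv []      []           = ℤ∣.divides 0ℤ refl
  F-divisible K {p} {g = g} dv (n ∷ u) (n<k ∷ u<k) =
    ℤ∣.∣m∣n⇒∣m+n head (F-divisible K (λ w w<k → dv (n ∷ w) (n<k ∷ w<k)) u u<k)
    where
    head : + p ∣ℤ wt K n * g (suc n ∷ u)
    head with n ℕ.≟ K
    ... | yes refl = ℤ∣.∣m⇒∣m*n _ (ℤ∣.∣n⇒∣m*n (+ suc n) (ℤ∣.divides 0ℤ (ℤ.+-inverseʳ (+ n))))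
    ... | no  n≢K  = ℤ∣.∣n⇒∣m*n (wt K n) (dv (suc n ∷ u) (s≤s (ℕ.≤∧≢⇒< (ℕ.≤-pred n<k) n≢K) ∷ u<k))

  -- Applying `F` to `E^ (suc m) g` yields (m + 1)(M - m) times `E^ m g`. Both factors lie strictly
  -- between 0 and p because m < M < p, so divisibility on the box passes from the power m + 1 to
  -- the power m.
  descend : ∀ {p K r d M} {g : Tensor r} → Prime p → Homogeneous d g → (∀ u → F K g u ≡ 0ℤ) →
            r ℕ.* K ≡ M ℕ.+ 2 ℕ.* d → M < p → ∀ m → m ≤ M →
            DivisibleOnBox (suc K) p (E^ m g) → DivisibleOnBox (suc K) p g
  descend pr hom Fg weight M<p zero    m≤M dv = dv
  descend {p} {K} {M = M} {g} pr hom Fg weight M<p (suc m) m<M dv =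
    descend pr hom Fg weight M<p m (ℕ.<⇒≤ m<M) dv′
    where
    dv′ : DivisibleOnBox (suc K) p (E^ m g)
    dv′ u u<k with euclidℤ pr (+ suc m * (+ M - + m)) (E^ m g u)
                     (subst (+ p ∣ℤ_) (F-E^ hom Fg weight m u) (F-divisible K dv u u<k))
    ... | inj₂ d = d
    ... | inj₁ d with euclidℤ pr (+ suc m) (+ M - + m) d
    ...   | inj₁ d₁ = contradiction d₁ (small-∤ (s≤s z≤n) (ℕ.≤-<-trans m<M M<p))
    ...   | inj₂ d₂ = contradiction (subst (+ p ∣ℤ_) (trans (ℤ.m-n≡m⊖n M m) (ℤ.⊖-≥ (ℕ.<⇒≤ m<M))) d₂)
                        (small-∤ (ℕ.m<n⇒0<n∸m m<M) (ℕ.≤-<-trans (ℕ.m∸n≤m M m) M<p))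

  -- Alternating tensors and the Vandermonde polynomial.

  data Swap : ∀ {r} → Vec ℕ r → Vec ℕ r → Set where
    here  : ∀ {r x y} {u : Vec ℕ r} → Swap (x ∷ y ∷ u) (y ∷ x ∷ u)
    there : ∀ {r x} {u v : Vec ℕ r} → Swap u v → Swap (x ∷ u) (x ∷ v)

  -- Adjacent transpositions generate all permutations, so this sign rule fixes the behaviour under
  -- every permutation.
  Alternating : ∀ {r} → Tensor r → Set
  Alternating g = ∀ {u v} → Swap u v → g v ≡ - g u

  -- `D` treats all coordinates alike, hence commutes with exchanging two of them.
  D-alternating : ∀ {c σ r} {g : Tensor r} → Alternating g → Alternating (D c σ g)
  D-alternating {c} {σ} {g = g} alt {x ∷ y ∷ u} here = begin
    c y * g (σ y ∷ x ∷ u) + (c x * g (y ∷ σ x ∷ u) + D c σ (x ◂ y ◂ g) u)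
      ≡⟨ cong₂ _+_ (cong (c y *_) (alt here)) (cong₂ _+_ (cong (c x *_) (alt here))
           (trans (D-cong (λ w → trans (alt here) (sym (ℤ.-1*i≡-i _))) u) (D-scale (- 1ℤ) (y ◂ x ◂ g) u))) ⟩
    c y * - g (x ∷ σ y ∷ u) + (c x * - g (σ x ∷ y ∷ u) + - 1ℤ * D c σ (y ◂ x ◂ g) u)
      ≡⟨ lem (c y) (g (x ∷ σ y ∷ u)) (c x) (g (σ x ∷ y ∷ u)) (D c σ (y ◂ x ◂ g) u) ⟩
    - (c x * g (σ x ∷ y ∷ u) + (c y * g (x ∷ σ y ∷ u) + D c σ (y ◂ x ◂ g) u)) ∎
    where
    open ≡-Reasoning
    lem : ∀ a b a′ b′ d → a * - b + (a′ * - b′ + - + 1 * d) ≡ - (a′ * b′ + (a * b + d))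
    lem = solve-∀
  D-alternating {c} {σ} {g = g} alt {n ∷ u} {_ ∷ v} (there s) = begin
    c n * g (σ n ∷ v) + D c σ (n ◂ g) v
      ≡⟨ cong₂ _+_ (cong (c n *_) (alt (there s))) (D-alternating (λ t → alt (there t)) s) ⟩
    c n * - g (σ n ∷ u) + - D c σ (n ◂ g) u ≡⟨ lem (c n) (g (σ n ∷ u)) (D c σ (n ◂ g) u) ⟩
    - (c n * g (σ n ∷ u) + D c σ (n ◂ g) u) ∎
    where
    open ≡-Reasoning
    lem : ∀ a b d → a * - b + - d ≡ - (a * b + d)
    lem = solve-∀

  x≡-x⇒x≡0 : ∀ {x} → x ≡ - x → x ≡ 0ℤ
  x≡-x⇒x≡0 {+ zero} eq = refl

  -- The first entry is swapped to the right until it stands next to its copy; there the sign rule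
  -- gives x = -x.
  alternating-∈ : ∀ {r} {g : Tensor (suc r)} → Alternating g → ∀ {n u} → Any (n ≡_) u → g (n ∷ u) ≡ 0ℤ
  alternating-∈ alt (here refl) = x≡-x⇒x≡0 (alt here)
  alternating-∈ {g = g} alt {n} {m ∷ u} (there n∈u) =
    trans (alt {m ∷ n ∷ u} here) (cong -_ (alternating-∈ {g = m ◂ g} (λ t → alt (there t)) n∈u))

  ¬Any⇒All : ∀ {r n} {u : Vec ℕ r} → ¬ Any (n ≡_) u → All (n ≢_) u
  ¬Any⇒All {u = []}    ¬any = []
  ¬Any⇒All {u = m ∷ u} ¬any = (λ eq → ¬any (here eq)) ∷ ¬Any⇒All (λ n∈u → ¬any (there n∈u))

  alternating-¬unique : ∀ {r} {g : Tensor r} → Alternating g → ∀ u → ¬ Unique u → g u ≡ 0ℤ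
  alternating-¬unique alt []      ¬uniq = contradiction [] ¬uniq
  alternating-¬unique {g = g} alt (n ∷ u) ¬uniq with any? (n ℕ.≟_) u
  ... | yes n∈u = alternating-∈ alt n∈u
  ... | no  n∉u = alternating-¬unique {g = n ◂ g} (λ t → alt (there t)) u (λ uniq → ¬uniq (¬Any⇒All n∉u ∷ uniq))

  unique? : ∀ {r} (u : Vec ℕ r) → Dec (Unique u)
  unique? = AllPairs.allPairs? (λ m n → ¬? (m ℕ.≟ n))

  -- This is r(r - 1)/2, the degree of the Vandermonde product and the least sum of r distinct
  -- exponents.
  triangle : ℕ → ℕ
  triangle zero    = 0
  triangle (suc r) = r ℕ.+ triangle r

  -- The entry removed is s if s occurs and the last one otherwise, so it is at least s and what
  -- remains exceeds s. The last component keeps the entries distinct when the recursion puts one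
  -- back in front.
  drop-least : ∀ {r} s (u : Vec ℕ (suc r)) → Unique u → All (s ≤_) u →
               ∃[ v ] Unique {n = r} v × All (suc s ≤_) v × s ℕ.+ sum v ≤ sum u ×
                      (∀ n → All (n ≢_) u → All (n ≢_) v)
  drop-least s (n ∷ u) (n∉u ∷ uniq) (s≤n ∷ s≤u) with n ℕ.≟ s
  ... | yes refl = u , uniq , All.map (λ (s≤m , s≢m) → ℕ.≤∧≢⇒< s≤m s≢m) (All.zip (s≤u , n∉u)) , ℕ.≤-refl , λ { _ (_ ∷ m∉u) → m∉u }
  drop-least s (n ∷ [])        _ (s≤n ∷ _) | no n≢s = [] , [] , [] , ℕ.+-monoˡ-≤ 0 s≤n , λ _ _ → []
  drop-least s (n ∷ u@(_ ∷ _)) (n∉u ∷ uniq) (s≤n ∷ s≤u) | no n≢s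
    with v , uniq′ , s<v , le , sub ← drop-least s u uniq s≤u =
    n ∷ v , sub n n∉u ∷ uniq′ , ℕ.≤∧≢⇒< s≤n (≢-sym n≢s) ∷ s<v
    , subst (_≤ n ℕ.+ sum u) (lem n s (sum v)) (ℕ.+-monoʳ-≤ n le)
    , λ { m (m≢n ∷ m∉u) → m≢n ∷ sub m m∉u }
    where
    lem : ∀ n s t → n ℕ.+ (s ℕ.+ t) ≡ s ℕ.+ (n ℕ.+ t)
    lem = ℕ-Solver.solve-∀

  -- Each removal raises the lower bound on the remaining entries by one, so together they account
  -- for s, s + 1, ..., s + r - 1.
  unique⇒sum≥ : ∀ {r} s (u : Vec ℕ r) → Unique u → All (s ≤_) u → r ℕ.* s ℕ.+ triangle r ≤ sum u
  unique⇒sum≥ {zero}  s []      _    _   = z≤n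
  unique⇒sum≥ {suc r} s u uniq s≤u with v , uniq′ , s<v , le , _ ← drop-least s u uniq s≤u =
    ℕ.≤-trans (subst (_≤ s ℕ.+ sum v) (lem s r (triangle r)) (ℕ.+-monoʳ-≤ s (unique⇒sum≥ (suc s) v uniq′ s<v))) le
    where
    lem : ∀ s r t → s ℕ.+ (r ℕ.* (1 ℕ.+ s) ℕ.+ t) ≡ (1 ℕ.+ r) ℕ.* s ℕ.+ (r ℕ.+ t)
    lem = ℕ-Solver.solve-∀

  sg : ℕ → ℕ → ℤ
  sg zero    zero    = 0ℤ
  sg zero    (suc n) = 1ℤ
  sg (suc m) zero    = - 1ℤ
  sg (suc m) (suc n) = sg m n

  sg-anti : ∀ m n → sg n m ≡ - sg m n
  sg-anti zero    zero    = refl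
  sg-anti zero    (suc n) = refl
  sg-anti (suc m) zero    = refl
  sg-anti (suc m) (suc n) = sg-anti m n

  sg-< : ∀ {m n} → m < n → sg m n ≡ 1ℤ
  sg-< {zero}  {suc n} m<n       = refl
  sg-< {suc m} {suc n} (s≤s m<n) = sg-< m<n

  sgs : ∀ {r} → ℕ → Vec ℕ r → ℤ
  sgs n []      = 1ℤ
  sgs n (m ∷ u) = sg n m * sgs n u

  -- A product of `sg` over all pairs of positions: the sign of the permutation that sorts the
  -- entries, and 0 if an entry repeats.
  sgn : ∀ {r} → Tensor r
  sgn []      = 1ℤ
  sgn (n ∷ u) = sgs n u * sgn u

  sgs-swap : ∀ {r} n {u v : Vec ℕ r} → Swap u v → sgs n v ≡ sgs n u
  sgs-swap n {x ∷ y ∷ u} here      = lem (sg n y) (sg n x) (sgs n u)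
    where
    lem : ∀ a b c → a * (b * c) ≡ b * (a * c)
    lem = solve-∀
  sgs-swap n {x ∷ u} (there s) = cong (sg n x *_) (sgs-swap n s)

  sgn-alternating : ∀ {r} → Alternating (sgn {r})
  sgn-alternating {u = x ∷ y ∷ u} here rewrite sg-anti x y = lem (sg x y) (sgs x u) (sgs y u) (sgn u)
    where
    lem : ∀ a b c d → - a * c * (b * d) ≡ - (a * b * (c * d))
    lem = solve-∀
  sgn-alternating {u = n ∷ u} (there s) rewrite sgs-swap n s | sgn-alternating s =
    sym (ℤ.neg-distribʳ-* (sgs n u) (sgn u))

  -- The coefficients of the Vandermonde product ∏ (xⱼ - xᵢ) over i < j.
  vandermonde : ∀ {r} → Tensor r
  vandermonde {r} u with sum u ℕ.≟ triangle r
  ... | yes _ = sgn u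
  ... | no  _ = 0ℤ

  vandermonde-homogeneous : ∀ {r} → Homogeneous (triangle r) (vandermonde {r})
  vandermonde-homogeneous {r} u ≢d with sum u ℕ.≟ triangle r
  ... | yes ≡d = contradiction ≡d ≢d
  ... | no  _  = refl

  sum-swap : ∀ {r} {u v : Vec ℕ r} → Swap u v → sum v ≡ sum u
  sum-swap {u = x ∷ y ∷ u} here = lem y x (sum u)
    where
    lem : ∀ a b c → a ℕ.+ (b ℕ.+ c) ≡ b ℕ.+ (a ℕ.+ c)
    lem = ℕ-Solver.solve-∀
  sum-swap {u = n ∷ u} (there s) = cong (n ℕ.+_) (sum-swap s)

  vandermonde-alternating : ∀ {r} → Alternating (vandermonde {r})
  vandermonde-alternating {r} {u} {v} s with sum u ℕ.≟ triangle r | sum v ℕ.≟ triangle r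
  ... | yes _  | yes _  = sgn-alternating s
  ... | no  _  | no  _  = refl
  ... | yes ≡d | no  ≢d = contradiction (trans (sum-swap s) ≡d) ≢d
  ... | no  ≢d | yes ≡d = contradiction (trans (sym (sum-swap s)) ≡d) ≢d

  -- `F` preserves alternation, so only indices with distinct entries matter. Their sum is at least
  -- `triangle r`, while `F` reads the Vandermonde tensor one degree higher, where it is zero.
  F-vandermonde : ∀ K {r} u → F K (vandermonde {r}) u ≡ 0ℤ
  F-vandermonde K {r} u with unique? u
  ... | no ¬uniq = alternating-¬unique (D-alternating {c = wt K} {σ = suc} (vandermonde-alternating {r})) u ¬uniq
  ... | yes uniq = trans (F-local K u (λ w e → vandermonde-homogeneous w (λ e′ → ℕ.<⇒≢ (above w e) (sym e′))))
                     (D-zero (λ _ → refl) u)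
    where
    above : ∀ w → sum w ≡ suc (sum u) → triangle r < sum w
    above w e = subst (triangle r <_) (sym e)
      (s≤s (subst (_≤ sum u) (cong (ℕ._+ triangle r) (ℕ.*-zeroʳ r)) (unique⇒sum≥ 0 u uniq (All.universal (λ _ → z≤n) u))))

  upFrom : ℕ → ∀ r → Vec ℕ r
  upFrom s zero    = []
  upFrom s (suc r) = s ∷ upFrom (suc s) r

  upFrom-≥ : ∀ s r → All (s ≤_) (upFrom s r)
  upFrom-≥ s zero    = []
  upFrom-≥ s (suc r) = ℕ.≤-refl ∷ All.map ℕ.<⇒≤ (upFrom-≥ (suc s) r)

  upFrom-< : ∀ s r → All (_< s ℕ.+ r) (upFrom s r)
  upFrom-< s zero    = []
  upFrom-< s (suc r) = ℕ.m<m+n s (s≤s z≤n) ∷ subst (λ t → All (_< t) (upFrom (suc s) r)) (sym (ℕ.+-suc s r)) (upFrom-< (suc s) r)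

  upFrom-sum : ∀ s r → sum (upFrom s r) ≡ r ℕ.* s ℕ.+ triangle r
  upFrom-sum s zero    = refl
  upFrom-sum s (suc r) rewrite upFrom-sum (suc s) r = lem s r (triangle r)
    where
    lem : ∀ s r t → s ℕ.+ (r ℕ.* (1 ℕ.+ s) ℕ.+ t) ≡ s ℕ.+ r ℕ.* s ℕ.+ (r ℕ.+ t)
    lem = ℕ-Solver.solve-∀

  sgs-< : ∀ {r n} {u : Vec ℕ r} → All (n <_) u → sgs n u ≡ 1ℤ
  sgs-< []          = refl
  sgs-< (n<m ∷ n<u) rewrite sg-< n<m | sgs-< n<u = refl

  sgn-upFrom : ∀ s r → sgn (upFrom s r) ≡ 1ℤ
  sgn-upFrom s zero    = refl
  sgn-upFrom s (suc r) rewrite sgs-< (upFrom-≥ (suc s) r) | sgn-upFrom (suc s) r = refl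

  vandermonde-upFrom : ∀ r → vandermonde (upFrom 0 r) ≡ 1ℤ
  vandermonde-upFrom r with sum (upFrom 0 r) ℕ.≟ triangle r
  ... | yes _  = sgn-upFrom 0 r
  ... | no  ≢d = contradiction (trans (upFrom-sum 0 r) (cong (ℕ._+ triangle r) (ℕ.*-zeroʳ r))) ≢d

  -- Finite sums of integers.

  ∑ : ℕ → (ℕ → ℤ) → ℤ
  ∑ zero    f = 0ℤ
  ∑ (suc k) f = ∑ k f + f k

  ∑-cong : ∀ k {f g : ℕ → ℤ} → (∀ n → f n ≡ g n) → ∑ k f ≡ ∑ k g
  ∑-cong zero    eq = refl
  ∑-cong (suc k) eq = cong₂ _+_ (∑-cong k eq) (eq k)

  ∑-linear : ∀ k x (f g : ℕ → ℤ) → ∑ k (λ n → x * f n + g n) ≡ x * ∑ k f + ∑ k g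
  ∑-linear zero    x f g = sym (trans (ℤ.+-identityʳ (x * 0ℤ)) (ℤ.*-zeroʳ x))
  ∑-linear (suc k) x f g rewrite ∑-linear k x f g = lem x (∑ k f) (∑ k g) (f k) (g k)
    where
    lem : ∀ x a b c d → x * a + b + (x * c + d) ≡ x * (a + c) + (b + d)
    lem = solve-∀

  ∑-zero : ∀ k → ∑ k (λ _ → 0ℤ) ≡ 0ℤ
  ∑-zero zero    = refl
  ∑-zero (suc k) rewrite ∑-zero k = refl

  ∑-scale : ∀ k x (f : ℕ → ℤ) → ∑ k (λ n → x * f n) ≡ x * ∑ k f
  ∑-scale k x f = begin
    ∑ k (λ n → x * f n)          ≡⟨ ∑-cong k (λ n → sym (ℤ.+-identityʳ (x * f n))) ⟩
    ∑ k (λ n → x * f n + 0ℤ)     ≡⟨ ∑-linear k x f (λ _ → 0ℤ) ⟩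
    x * ∑ k f + ∑ k (λ _ → 0ℤ)   ≡⟨ cong (λ y → x * ∑ k f + y) (∑-zero k) ⟩
    x * ∑ k f + 0ℤ               ≡⟨ ℤ.+-identityʳ _ ⟩
    x * ∑ k f                    ∎
    where open ≡-Reasoning

  ∑-swap : ∀ k l (f : ℕ → ℕ → ℤ) → ∑ k (λ m → ∑ l (f m)) ≡ ∑ l (λ n → ∑ k (λ m → f m n))
  ∑-swap zero    l f = sym (∑-zero l)
  ∑-swap (suc k) l f = begin
    ∑ k (λ m → ∑ l (f m)) + ∑ l (f k)                    ≡⟨ cong (_+ ∑ l (f k)) (trans (∑-swap k l f) (sym (ℤ.*-identityˡ _))) ⟩
    1ℤ * ∑ l (λ n → ∑ k (λ m → f m n)) + ∑ l (f k)       ≡⟨ sym (∑-linear l 1ℤ (λ n → ∑ k (λ m → f m n)) (f k)) ⟩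
    ∑ l (λ n → 1ℤ * ∑ k (λ m → f m n) + f k n)           ≡⟨ ∑-cong l (λ n → cong (_+ f k n) (ℤ.*-identityˡ (∑ k (λ m → f m n)))) ⟩
    ∑ l (λ n → ∑ k (λ m → f m n) + f k n)                ∎
    where open ≡-Reasoning

  ∑-divisible : ∀ k {q f} → (∀ n → n < k → q ∣ℤ f n) → q ∣ℤ ∑ k f
  ∑-divisible zero    {q} dv = ℤ∣.divides 0ℤ refl
  ∑-divisible (suc k) dv = ℤ∣.∣m∣n⇒∣m+n (∑-divisible k (λ n n<k → dv n (ℕ.m<n⇒m<1+n n<k))) (dv k ℕ.≤-refl)

  ∑-isolate : ∀ k {q f n} → n < k → (∀ m → m < k → m ≢ n → q ∣ℤ f m) → q ∣ℤ ∑ k f → q ∣ℤ f n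
  ∑-isolate (suc k) {n = n} n<k dv total with n ℕ.≟ k
  ... | yes refl = ℤ∣.∣m+n∣m⇒∣n total (∑-divisible k (λ m m<k → dv m (ℕ.m<n⇒m<1+n m<k) (ℕ.<⇒≢ m<k)))
  ... | no  n≢k  = ∑-isolate k (ℕ.≤∧≢⇒< (ℕ.≤-pred n<k) n≢k) (λ m m<k → dv m (ℕ.m<n⇒m<1+n m<k))
                     (ℤ∣.∣m+n∣n⇒∣m total (dv k ℕ.≤-refl (≢-sym n≢k)))

  -- Evaluation of truncated Newton expansions on a grid.

  module Evaluation (K : ℕ) (a : ℕ → ℤ) where

    k : ℕ
    k = suc K

    newton : ℕ → ℤ → ℤ
    newton zero    x = 1ℤ
    newton (suc n) x = newton n x * (x - a n)

    newton-root : ∀ {n j} → j < n → newton n (a j) ≡ 0ℤ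
    newton-root {suc n} {j} j<n with j ℕ.≟ n
    ... | yes refl rewrite ℤ.+-inverseʳ (a j) = ℤ.*-zeroʳ (newton j (a j))
    ... | no  j≢n  rewrite newton-root (ℕ.≤∧≢⇒< (ℕ.≤-pred j<n) j≢n) = refl

    -- The coefficients of g are read in the Newton basis, and only those with all
    -- indices below k count: newton n vanishes at a j whenever j < k ≤ n.
    ev : ∀ {r} → Vec ℕ r → Tensor r → ℤ
    ev []       g = g []
    ev (j ∷ js) g = ∑ k (λ n → newton n (a j) * ev js (n ◂ g))

    ev-cong : ∀ {r} (js : Vec ℕ r) {f g} → (∀ u → f u ≡ g u) → ev js f ≡ ev js g
    ev-cong []       eq = eq []
    ev-cong (j ∷ js) eq = ∑-cong k (λ n → cong (newton n (a j) *_) (ev-cong js (λ u → eq (n ∷ u))))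

    ev-linear : ∀ {r} (js : Vec ℕ r) x f g → ev js (λ u → x * f u + g u) ≡ x * ev js f + ev js g
    ev-linear []       x f g = refl
    ev-linear (j ∷ js) x f g = begin
      ∑ k (λ n → v n * ev js (λ u → x * f (n ∷ u) + g (n ∷ u)))
        ≡⟨ ∑-cong k (λ n → trans (cong (v n *_) (ev-linear js x (n ◂ f) (n ◂ g)))
                                 (lem (v n) x (ev js (n ◂ f)) (ev js (n ◂ g)))) ⟩
      ∑ k (λ n → x * (v n * ev js (n ◂ f)) + v n * ev js (n ◂ g))
        ≡⟨ ∑-linear k x (λ n → v n * ev js (n ◂ f)) (λ n → v n * ev js (n ◂ g)) ⟩
      x * ev (j ∷ js) f + ev (j ∷ js) g ∎
      where
      open ≡-Reasoning
      v : ℕ → ℤ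
      v n = newton n (a j)
      lem : ∀ v x a b → v * (x * a + b) ≡ x * (v * a) + v * b
      lem = solve-∀

    ev-neg : ∀ {r} (js : Vec ℕ r) g → ev js (λ u → - g u) ≡ - ev js g
    ev-neg []       g = refl
    ev-neg (j ∷ js) g = begin
      ∑ k (λ n → newton n (a j) * ev js (λ u → - g (n ∷ u)))
        ≡⟨ ∑-cong k (λ n → trans (cong (newton n (a j) *_) (ev-neg js (n ◂ g))) (lem (newton n (a j)) (ev js (n ◂ g)))) ⟩
      ∑ k (λ n → - 1ℤ * (newton n (a j) * ev js (n ◂ g)))
        ≡⟨ ∑-scale k (- 1ℤ) (λ n → newton n (a j) * ev js (n ◂ g)) ⟩
      - 1ℤ * ev (j ∷ js) g
        ≡⟨ ℤ.-1*i≡-i _ ⟩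
      - ev (j ∷ js) g ∎
      where
      open ≡-Reasoning
      lem : ∀ a b → a * - b ≡ - + 1 * (a * b)
      lem = solve-∀

    -- All variables use the same Newton basis, so exchanging two arguments amounts to exchanging
    -- two summation indices, and the sign then comes from `g`.
    ev-alternating : ∀ {r} {g : Tensor r} → Alternating g → Alternating (λ js → ev js g)
    ev-alternating {g = g} alt {x ∷ y ∷ js} here = begin
      ∑ k (λ n → v y n * ∑ k (λ m → v x m * ev js (m ◂ n ◂ g)))
        ≡⟨ ∑-cong k (λ n → sym (∑-scale k (v y n) (λ m → v x m * ev js (m ◂ n ◂ g)))) ⟩
      ∑ k (λ n → ∑ k (λ m → v y n * (v x m * ev js (m ◂ n ◂ g))))
        ≡⟨ ∑-swap k k (λ n m → v y n * (v x m * ev js (m ◂ n ◂ g))) ⟩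
      ∑ k (λ m → ∑ k (λ n → v y n * (v x m * ev js (m ◂ n ◂ g))))
        ≡⟨ ∑-cong k (λ m → trans (∑-cong k (λ n → flip m n)) (∑-scale k (- v x m) (λ n → v y n * ev js (n ◂ m ◂ g)))) ⟩
      ∑ k (λ m → - v x m * ev (y ∷ js) (m ◂ g))
        ≡⟨ ∑-cong k (λ m → lem′ (v x m) (ev (y ∷ js) (m ◂ g))) ⟩
      ∑ k (λ m → - 1ℤ * (v x m * ev (y ∷ js) (m ◂ g)))
        ≡⟨ trans (∑-scale k (- 1ℤ) (λ m → v x m * ev (y ∷ js) (m ◂ g))) (ℤ.-1*i≡-i _) ⟩
      - ev (x ∷ y ∷ js) g ∎
      where
      open ≡-Reasoning
      v : ℕ → ℕ → ℤ
      v x n = newton n (a x)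
      lem : ∀ a b c → a * (b * - c) ≡ - b * (a * c)
      lem = solve-∀
      lem′ : ∀ a b → - a * b ≡ - + 1 * (a * b)
      lem′ = solve-∀
      flip : ∀ m n → v y n * (v x m * ev js (m ◂ n ◂ g)) ≡ - v x m * (v y n * ev js (n ◂ m ◂ g))
      flip m n = trans
        (cong (λ e → v y n * (v x m * e)) (trans (ev-cong js (λ u → alt here)) (ev-neg js (n ◂ m ◂ g))))
        (lem (v y n) (v x m) (ev js (n ◂ m ◂ g)))
    ev-alternating {g = g} alt {x ∷ js} {_ ∷ js′} (there s) = begin
      ∑ k (λ n → newton n (a x) * ev js′ (n ◂ g))
        ≡⟨ ∑-cong k (λ n → trans (cong (newton n (a x) *_) (ev-alternating {g = n ◂ g} (λ t → alt (there t)) s))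
                                 (lem (newton n (a x)) (ev js (n ◂ g)))) ⟩
      ∑ k (λ n → - 1ℤ * (newton n (a x) * ev js (n ◂ g)))
        ≡⟨ trans (∑-scale k (- 1ℤ) (λ n → newton n (a x) * ev js (n ◂ g))) (ℤ.-1*i≡-i _) ⟩
      - ev (x ∷ js) g ∎
      where
      open ≡-Reasoning
      lem : ∀ a b → a * - b ≡ - + 1 * (a * b)
      lem = solve-∀

    asum : ∀ {r} → Vec ℕ r → ℤ
    asum []       = 0ℤ
    asum (j ∷ js) = a j + asum js

    -- Multiplication by x₁ + ⋯ + xᵣ in the Newton basis, where x vₙ = vₙ₊₁ + aₙ vₙ.
    X : ∀ {r} → Tensor r → Tensor r
    X g u = E g u + asum u * g u

    -- Since x vₙ = vₙ₊₁ + aₙ vₙ for vₙ = `newton n x`, multiplication by x moves part of each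
    -- coefficient up by one index. Truncation loses exactly the overflow of the top coefficient,
    -- which is the extra term on the left.
    telescope : ∀ K x (φ : ℕ → ℤ) →
      ∑ (suc K) (λ n → newton n x * (δ n * φ (pred n) + a n * φ n)) + newton (suc K) x * φ K
      ≡ x * ∑ (suc K) (λ n → newton n x * φ n)
    telescope zero    x φ = lem x (a 0) (φ 0)
      where
      lem : ∀ x a f → + 0 + + 1 * (+ 0 * f + a * f) + + 1 * (x - a) * f ≡ x * (+ 0 + + 1 * f)
      lem = solve-∀
    telescope (suc K) x φ = begin
      S + V * (1ℤ * φ K + a (suc K) * φ (suc K)) + V * (x - a (suc K)) * φ (suc K)
        ≡⟨ lem₁ S V (φ K) (a (suc K)) (φ (suc K)) x ⟩
      S + V * φ K + x * (V * φ (suc K))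
        ≡⟨ cong (_+ x * (V * φ (suc K))) (telescope K x φ) ⟩
      x * S′ + x * (V * φ (suc K))
        ≡⟨ sym (ℤ.*-distribˡ-+ x S′ (V * φ (suc K))) ⟩
      x * (S′ + V * φ (suc K)) ∎
      where
      open ≡-Reasoning
      S S′ V : ℤ
      S = ∑ (suc K) (λ n → newton n x * (δ n * φ (pred n) + a n * φ n))
      S′ = ∑ (suc K) (λ n → newton n x * φ n)
      V = newton (suc K) x
      lem₁ : ∀ S V f a f′ x → S + V * (+ 1 * f + a * f′) + V * (x - a) * f′ ≡ S + V * f + x * (V * f′)
      lem₁ = solve-∀

    -- The overflow term of `telescope` vanishes at the nodes with index below k, so there
    -- truncation is compatible with multiplication.
    ev-X : ∀ {r} (js : Vec ℕ r) → All (_< k) js → ∀ g → ev js (X g) ≡ asum js * ev js g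
    ev-X []       _            g = ℤ.+-identityˡ _
    ev-X (j ∷ js) (j<k ∷ js<k) g = begin
      ∑ k (λ n → v n * ev js (n ◂ X g)) ≡⟨ ∑-cong k slice ⟩
      ∑ k (λ n → asum js * (v n * φ n) + v n * (δ n * φ (pred n) + a n * φ n))
        ≡⟨ ∑-linear k (asum js) (λ n → v n * φ n) (λ n → v n * (δ n * φ (pred n) + a n * φ n)) ⟩
      asum js * ev (j ∷ js) g + S
        ≡⟨ cong (λ e → asum js * ev (j ∷ js) g + e) S≡ ⟩
      asum js * ev (j ∷ js) g + a j * ev (j ∷ js) g
        ≡⟨ lem (asum js) (a j) (ev (j ∷ js) g) ⟩
      (a j + asum js) * ev (j ∷ js) g ∎
      where
      open ≡-Reasoning
      v φ : ℕ → ℤ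
      v n = newton n (a j)
      φ n = ev js (n ◂ g)
      S : ℤ
      S = ∑ k (λ n → v n * (δ n * φ (pred n) + a n * φ n))
      S≡ : S ≡ a j * ev (j ∷ js) g
      S≡ = trans (sym (ℤ.+-identityʳ S))
             (trans (cong (λ z → S + z * φ K) (sym (newton-root j<k))) (telescope K (a j) φ))
      lem : ∀ s x e → s * e + x * e ≡ (x + s) * e
      lem = solve-∀
      lem₁ : ∀ d p e b s q → d * p + e + (b + s) * q ≡ d * p + (b * q + (e + s * q))
      lem₁ = solve-∀
      lem₂ : ∀ v d p b q s → v * (d * p + (b * q + s * q)) ≡ s * (v * q) + v * (d * p + b * q)
      lem₂ = solve-∀
      slice : ∀ n → v n * ev js (n ◂ X g) ≡ asum js * (v n * φ n) + v n * (δ n * φ (pred n) + a n * φ n)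
      slice n = begin
        v n * ev js (n ◂ X g)
          ≡⟨ cong (v n *_) (ev-cong js (λ u → lem₁ (δ n) (g (pred n ∷ u)) (E (n ◂ g) u) (a n) (asum u) (g (n ∷ u)))) ⟩
        v n * ev js (λ u → δ n * g (pred n ∷ u) + (a n * g (n ∷ u) + X (n ◂ g) u))
          ≡⟨ cong (v n *_) (trans (ev-linear js (δ n) (pred n ◂ g) _)
               (cong (λ e → δ n * φ (pred n) + e) (trans (ev-linear js (a n) (n ◂ g) (X (n ◂ g)))
                 (cong (λ e → a n * φ n + e) (ev-X js js<k (n ◂ g)))))) ⟩
        v n * (δ n * φ (pred n) + (a n * φ n + asum js * φ n))
          ≡⟨ lem₂ (v n) (δ n) (φ (pred n)) (a n) (φ n) (asum js) ⟩
        asum js * (v n * φ n) + v n * (δ n * φ (pred n) + a n * φ n) ∎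

    X-_ : ∀ {r} → ℤ → Tensor r → Tensor r
    (X- c) g u = - c * g u + X g u

    ev-X- : ∀ {r} (js : Vec ℕ r) → All (_< k) js → ∀ c g → ev js ((X- c) g) ≡ (asum js - c) * ev js g
    ev-X- js js<k c g = begin
      ev js (λ u → - c * g u + X g u)         ≡⟨ ev-linear js (- c) g (X g) ⟩
      - c * ev js g + ev js (X g)             ≡⟨ cong (λ e → - c * ev js g + e) (ev-X js js<k g) ⟩
      - c * ev js g + asum js * ev js g       ≡⟨ lem c (asum js) (ev js g) ⟩
      (asum js - c) * ev js g                 ∎
      where
      open ≡-Reasoning
      lem : ∀ c s e → - c * e + s * e ≡ (s - c) * e
      lem = solve-∀

    ∏X- : ∀ {r} → List ℤ → Tensor r → Tensor r
    ∏X- C g = List.foldr X-_ g C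

    ev-∏X- : ∀ {q r} (js : Vec ℕ r) → All (_< k) js → ∀ C g →
             ListAny.Any (λ c → q ∣ℤ asum js - c) C → q ∣ℤ ev js (∏X- C g)
    ev-∏X- js js<k (c ∷ C) g (ListAny.here dv) rewrite ev-X- js js<k c (∏X- C g) = ℤ∣.∣m⇒∣m*n _ dv
    ev-∏X- js js<k (c ∷ C) g (ListAny.there e) rewrite ev-X- js js<k c (∏X- C g) =
      ℤ∣.∣n⇒∣m*n (asum js - c) (ev-∏X- js js<k C g e)

    ev-∏X-zero : ∀ {r} (js : Vec ℕ r) → All (_< k) js → ∀ C g → ev js g ≡ 0ℤ → ev js (∏X- C g) ≡ 0ℤ
    ev-∏X-zero js js<k []      g eq = eq
    ev-∏X-zero js js<k (c ∷ C) g eq rewrite ev-X- js js<k c (∏X- C g) | ev-∏X-zero js js<k C g eq = ℤ.*-zeroʳ (asum js - c)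

    -- Each factor is `E` plus terms that keep the degree, and the latter cannot reach the top
    -- degree. The claim also covers all higher degrees, where both sides vanish: the induction uses
    -- this to discard the degree-preserving terms.
    ∏X-top : ∀ {r d} {g : Tensor r} → Homogeneous d g → ∀ C u → length C ℕ.+ d ≤ sum u →
             ∏X- C g u ≡ E^ (length C) g u
    ∏X-top hom []      u le = refl
    ∏X-top {g = g} hom (c ∷ C) u le = begin
      - c * ∏X- C g u + (E (∏X- C g) u + asum u * ∏X- C g u)
        ≡⟨ cong₂ (λ x y → - c * x + (y + asum u * x)) zero! (E-local u (λ w e → ∏X-top hom C w (ℕ.≤-pred (subst (_ ≤_) (sym e) le)))) ⟩
      - c * 0ℤ + (E (E^ (length C) g) u + asum u * 0ℤ)
        ≡⟨ lem c (E (E^ (length C) g) u) (asum u) ⟩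
      E (E^ (length C) g) u ∎
      where
      open ≡-Reasoning
      zero! : ∏X- C g u ≡ 0ℤ
      zero! = trans (∏X-top hom C u (ℕ.<⇒≤ le)) (E^-homogeneous hom (length C) u (≢-sym (ℕ.<⇒≢ le)))
      lem : ∀ c e s → - c * + 0 + (e + s * + 0) ≡ e
      lem = solve-∀

    -- Interpolation modulo p and the bound of Dias da Silva and Hamidoune.

    module _ {p : ℕ} (pr : Prime p) (a-distinct : ∀ {i j} → i < j → j < k → ¬ + p ∣ℤ a j - a i) where

      newton-∤ : ∀ {n j} → n ≤ j → j < k → ¬ + p ∣ℤ newton n (a j)
      newton-∤ {zero}      _   _   dv =
        small-∤ (s≤s z≤n) (ℕ.nonTrivial⇒n>1 p {{prime⇒nonTrivial pr}}) dv
      newton-∤ {suc n} {j} n<j j<k dv with euclidℤ pr (newton n (a j)) (a j - a n) dv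
      ... | inj₁ d = newton-∤ (ℕ.<⇒≤ n<j) j<k d
      ... | inj₂ d = a-distinct n<j j<k d

      -- The system is triangular: at node n the terms with index above n vanish, and the
      -- coefficient of `φ n` is prime to p. Forward substitution settles one value after the other.
      interpolate₁ : ∀ (φ : ℕ → ℤ) → (∀ j → j < k → + p ∣ℤ ∑ k (λ n → newton n (a j) * φ n)) →
                     ∀ n → n < k → + p ∣ℤ φ n
      interpolate₁ φ dv n n<k = below (suc n) n<k n ℕ.≤-refl
        where
        others : ∀ n → (∀ m → m < n → + p ∣ℤ φ m) → ∀ m → m < k → m ≢ n → + p ∣ℤ newton m (a n) * φ m
        others n below m _ m≢n with ℕ.<-cmp m n
        ... | tri< m<n _ _ = ℤ∣.∣n⇒∣m*n (newton m (a n)) (below m m<n)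
        ... | tri≈ _ m≡n _ = contradiction m≡n m≢n
        ... | tri> _ _ n<m = ℤ∣.divides 0ℤ (cong (_* φ m) (newton-root n<m))
        below : ∀ b → b ≤ k → ∀ n → n < b → + p ∣ℤ φ n
        below (suc b) b<k n n<1+b with n ℕ.≟ b
        ... | no n≢b = below b (ℕ.<⇒≤ b<k) n (ℕ.≤∧≢⇒< (ℕ.≤-pred n<1+b) n≢b)
        ... | yes refl with euclidℤ pr (newton n (a n)) (φ n)
                              (∑-isolate k b<k (others n (below n (ℕ.<⇒≤ b<k))) (dv n b<k))
        ...   | inj₁ d = contradiction d (newton-∤ ℕ.≤-refl b<k)
        ...   | inj₂ d = d

      -- One variable at a time: with the other arguments fixed, `interpolate₁` replaces the first
      -- argument by an index.
      interpolate : ∀ {r} (g : Tensor r) → (∀ js → All (_< k) js → + p ∣ℤ ev js g) → DivisibleOnBox k p g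
      interpolate g dv []      []            = dv [] []
      interpolate g dv (n ∷ u) (n<k ∷ u<k) = interpolate (n ◂ g)
        (λ js js<k → interpolate₁ (λ m → ev js (m ◂ g)) (λ j j<k → dv (j ∷ js) (j<k ∷ js<k)) n n<k) u u<k

      -- Dias da Silva–Hamidoune
      sum-cover-length : ∀ {r M} → r ℕ.* K ≡ M ℕ.+ 2 ℕ.* triangle r → r ≤ k → M < p → (C : List ℤ) →
        (∀ (js : Vec ℕ r) → All (_< k) js → Unique js → ListAny.Any (λ c → + p ∣ℤ asum js - c) C) →
        M < length C
      sum-cover-length {r} {M} weight r≤k M<p C cover with length C ℕ.≤? M
      ... | no  ≰M = ℕ.≰⇒> ≰M
      ... | yes ≤M = contradiction (subst (+ p ∣ℤ_) (vandermonde-upFrom r) bottom)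
                       (small-∤ (s≤s z≤n) (ℕ.nonTrivial⇒n>1 p {{prime⇒nonTrivial pr}}))
        where
        g : Tensor r
        g = vandermonde
        -- At distinct indices some factor of the product is divisible by p; at repeated ones the
        -- value of the Vandermonde tensor is already 0.
        ev-divisible : ∀ js → All (_< k) js → + p ∣ℤ ev js (∏X- C g)
        ev-divisible js js<k with unique? js
        ... | yes uniq  = ev-∏X- js js<k C g (cover js js<k uniq)
        ... | no  ¬uniq = ℤ∣.divides 0ℤ (ev-∏X-zero js js<k C g
                (alternating-¬unique {g = λ js → ev js g} (ev-alternating {g = g} vandermonde-alternating) js ¬uniq))
        -- In degree `length C` + `triangle r` the Newton coefficients of the product are those of
        -- `E^ (length C) g`; in every other degree the latter are 0.
        top : DivisibleOnBox k p (E^ (length C) g)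
        top u u<k with sum u ℕ.≟ length C ℕ.+ triangle r
        ... | no  ≢d = ℤ∣.divides 0ℤ (E^-homogeneous vandermonde-homogeneous (length C) u ≢d)
        ... | yes ≡d = subst (+ p ∣ℤ_) (∏X-top vandermonde-homogeneous C u (ℕ.≤-reflexive (sym ≡d)))
                         (interpolate (∏X- C g) ev-divisible u u<k)
        -- r ≤ k puts the exponents 0, ..., r - 1 inside the box; the Vandermonde coefficient there
        -- is 1, which p cannot divide.
        bottom : + p ∣ℤ g (upFrom 0 r)
        bottom = descend pr vandermonde-homogeneous (F-vandermonde K) weight M<p (length C) ≤M top
                   (upFrom 0 r) (All.map (λ u<r → ℕ.<-≤-trans u<r r≤k) (upFrom-< 0 r))

open Tensors
open import Data.Nat using (_+_; _*_; _∸_)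
open import Data.Nat.Tactic.RingSolver using (solve-∀)
open Equivalence using (to; from)
open import Algebra.Properties.CommutativeMonoid.Sum ℕ.+-0-commutativeMonoid using (∑-distrib-+; sum-permute; sum-cong-≗) renaming (sum to ∑ᶠ)

-- Subsets of a finite type and their cardinalities.

Subset : ℕ → Set
Subset n = Fin n → Bool

infix 4 _∈_ _∉_ _⊆_
-- Wrapping `T (S x)` in a record lets x and S be inferred from a membership proof.
record _∈_ {n} (x : Fin n) (S : Subset n) : Set where
  constructor mem
  field holds : T (S x)
open _∈_

_∉_ : ∀ {n} → Fin n → Subset n → Set
x ∉ S = ¬ x ∈ S

_⊆_ : ∀ {n} → Subset n → Subset n → Set
S ⊆ S′ = ∀ {x} → x ∈ S → x ∈ S′

infix 4 _∈?_
_∈?_ : ∀ {n} (x : Fin n) S → Dec (x ∈ S)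
x ∈? S with T? (S x)
... | yes t = yes (mem t)
... | no ¬t = no (λ x∈S → ¬t (holds x∈S))

⟪_⟫ : ∀ {n} {P : Fin n → Set} → Decidable P → Subset n
⟪ P? ⟫ x = ⌊ P? x ⌋

module _ {n} {P : Fin n → Set} {P? : Decidable P} where

  ∈⟪⟫⁺ : ∀ {x} → P x → x ∈ ⟪ P? ⟫
  ∈⟪⟫⁺ {x} px = mem (fromWitness {a? = P? x} px)

  ∈⟪⟫⁻ : ∀ {x} → x ∈ ⟪ P? ⟫ → P x
  ∈⟪⟫⁻ {x} (mem t) = toWitness {a? = P? x} t

infixr 7 _∩_
infixr 6 _∪_
_∪_ _∩_ : ∀ {n} → Subset n → Subset n → Subset n
(S ∪ S′) x = S x ∨ S′ x
(S ∩ S′) x = S x ∧ S′ x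

∁ : ∀ {n} → Subset n → Subset n
∁ S x = not (S x)

⁅_⁆ : ∀ {n} → Fin n → Subset n
⁅ x ⁆ = ⟪ x Fin.≟_ ⟫

∅ : ∀ {n} → Subset n
∅ _ = false

module _ {n} {S S′ : Subset n} where

  ∈∩⁺ : ∀ {x} → x ∈ S → x ∈ S′ → x ∈ S ∩ S′
  ∈∩⁺ (mem s) (mem s′) = mem (from T-∧ (s , s′))

  ∈∩⁻ : ∀ {x} → x ∈ S ∩ S′ → x ∈ S × x ∈ S′
  ∈∩⁻ {x} (mem t) with s , s′ ← to (T-∧ {S x} {S′ x}) t = mem s , mem s′

  ∈∪⁺ˡ : ∀ {x} → x ∈ S → x ∈ S ∪ S′
  ∈∪⁺ˡ {x} (mem s) = mem (from (T-∨ {S x} {S′ x}) (inj₁ s))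

  ∈∪⁺ʳ : ∀ {x} → x ∈ S′ → x ∈ S ∪ S′
  ∈∪⁺ʳ {x} (mem s) = mem (from (T-∨ {S x} {S′ x}) (inj₂ s))

  ∈∪⁻ : ∀ {x} → x ∈ S ∪ S′ → x ∈ S ⊎ x ∈ S′
  ∈∪⁻ {x} (mem t) with to (T-∨ {S x} {S′ x}) t
  ... | inj₁ s = inj₁ (mem s)
  ... | inj₂ s = inj₂ (mem s)

∈∁⁺ : ∀ {n} {S : Subset n} {x} → x ∉ S → x ∈ ∁ S
∈∁⁺ {S = S} {x} x∉S = mem (lem (S x) (λ t → x∉S (mem t)))
  where
  lem : ∀ b → ¬ T b → T (not b)
  lem true  ¬t = contradiction _ ¬t
  lem false ¬t = _

∈∁⁻ : ∀ {n} {S : Subset n} {x} → x ∈ ∁ S → x ∉ S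
∈∁⁻ {S = S} {x} (mem t) (mem s) = lem (S x) t s
  where
  lem : ∀ b → T (not b) → ¬ T b
  lem false _ ()

∈⁅⁆ : ∀ {n} {x : Fin n} → x ∈ ⁅ x ⁆
∈⁅⁆ {x = x} = ∈⟪⟫⁺ {P? = x Fin.≟_} refl

∈⁅⁆⁻ : ∀ {n} {x y : Fin n} → y ∈ ⁅ x ⁆ → x ≡ y
∈⁅⁆⁻ {x = x} = ∈⟪⟫⁻ {P? = x Fin.≟_}

ind : Bool → ℕ
ind b = if b then 1 else 0

card : ∀ {n} → Subset n → ℕ
card S = ∑ᶠ (λ x → ind (S x))

sum-mono : ∀ {n} {f g : Fin n → ℕ} → (∀ x → f x ≤ g x) → ∑ᶠ f ≤ ∑ᶠ g
sum-mono {zero}  le = z≤n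
sum-mono {suc n} le = ℕ.+-mono-≤ (le Fin.zero) (sum-mono (λ x → le (Fin.suc x)))

card-mono : ∀ {n} {S S′ : Subset n} → S ⊆ S′ → card S ≤ card S′
card-mono {S = S} {S′} S⊆S′ = sum-mono (λ x → lem (S x) (S′ x) (λ t → holds (S⊆S′ (mem t))))
  where
  lem : ∀ b b′ → (T b → T b′) → ind b ≤ ind b′
  lem false b′    f = z≤n
  lem true  true  f = s≤s z≤n
  lem true  false f = contradiction (f _) (λ ())

card-∪∩ : ∀ {n} (S S′ : Subset n) → card (S ∪ S′) + card (S ∩ S′) ≡ card S + card S′
card-∪∩ S S′ = begin
  card (S ∪ S′) + card (S ∩ S′)                   ≡⟨ sym (∑-distrib-+ (λ x → ind (S x ∨ S′ x)) (λ x → ind (S x ∧ S′ x))) ⟩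
  ∑ᶠ (λ x → ind (S x ∨ S′ x) + ind (S x ∧ S′ x)) ≡⟨ sum-cong-≗ (λ x → lem (S x) (S′ x)) ⟩
  ∑ᶠ (λ x → ind (S x) + ind (S′ x))              ≡⟨ ∑-distrib-+ (λ x → ind (S x)) (λ x → ind (S′ x)) ⟩
  card S + card S′                                ∎
  where
  open ≡-Reasoning
  lem : ∀ b b′ → ind (b ∨ b′) + ind (b ∧ b′) ≡ ind b + ind b′
  lem false false = refl
  lem false true  = refl
  lem true  false = refl
  lem true  true  = refl

sum-ones : ∀ n → ∑ᶠ {n} (λ _ → 1) ≡ n
sum-ones zero    = refl
sum-ones (suc n) = cong suc (sum-ones n)

sum-zeros : ∀ n → ∑ᶠ {n} (λ _ → 0) ≡ 0
sum-zeros zero    = refl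
sum-zeros (suc n) = sum-zeros n

card-∁ : ∀ {n} (S : Subset n) → card S + card (∁ S) ≡ n
card-∁ {n} S = trans (sym (∑-distrib-+ (λ x → ind (S x)) (λ x → ind (not (S x)))))
                 (trans (sum-cong-≗ (λ x → lem (S x))) (sum-ones n))
  where
  lem : ∀ b → ind b + ind (not b) ≡ 1
  lem false = refl
  lem true  = refl

card-permute : ∀ {n} (S : Subset n) (f g : Fin n → Fin n) → (∀ x → f (g x) ≡ x) → (∀ x → g (f x) ≡ x) →
               card (λ x → S (f x)) ≡ card S
card-permute S f g fg gf = sym (sum-permute (λ x → ind (S x))
  (permutation f g fg gf))

card-empty : ∀ {n} {S : Subset n} → (∀ {x} → x ∉ S) → card S ≡ 0
card-empty {n} {S} ¬S = ℕ.n≤0⇒n≡0 (subst (card S ≤_) (sum-zeros n) (card-mono {S′ = ∅} (λ x∈S → contradiction x∈S ¬S)))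

card-point : ∀ {n} (x : Fin n) → card ⁅ x ⁆ ≡ 1
card-point {suc n} Fin.zero    = cong suc (sum-zeros n)
card-point {suc n} (Fin.suc x) = trans (ℕ.≤-antisym
    (card-mono {S = λ y → ⁅ Fin.suc x ⁆ (Fin.suc y)} {⁅ x ⁆} (λ { (mem t) → ∈⟪⟫⁺ {P? = x Fin.≟_} (Fin.suc-injective (∈⁅⁆⁻ (mem t))) }))
    (card-mono {S = ⁅ x ⁆} (λ y∈ → mem (holds (∈⟪⟫⁺ {P? = Fin.suc x Fin.≟_} (cong Fin.suc (∈⁅⁆⁻ y∈)))))))
  (card-point x)

inhabited : ∀ {n} {S : Subset n} → 1 ≤ card S → ∃[ x ] x ∈ S
inhabited {S = S} 1≤ with Fin.any? (_∈? S)
... | yes e = e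
... | no ¬e = contradiction 1≤ (ℕ.<⇒≱ (s≤s (ℕ.≤-reflexive (card-empty {S = S} (λ {x} x∈S → ¬e (x , x∈S))))))

infixl 8 _∖_
_∖_ : ∀ {n} → Subset n → Fin n → Subset n
S ∖ x = S ∩ ∁ ⁅ x ⁆

module _ {n} {S : Subset n} where

  ∈∖⁺ : ∀ {x y} → y ∈ S → x ≢ y → y ∈ S ∖ x
  ∈∖⁺ y∈S x≢y = ∈∩⁺ y∈S (∈∁⁺ (λ y∈ → x≢y (∈⁅⁆⁻ y∈)))

  ∖⊆ : ∀ {x} → S ∖ x ⊆ S
  ∖⊆ y∈ = proj₁ (∈∩⁻ y∈)

  ∉∖ : ∀ {x} → x ∉ S ∖ x
  ∉∖ x∈ = ∈∁⁻ (proj₂ (∈∩⁻ {S = S} x∈)) ∈⁅⁆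

  card-∖ : ∀ {x} → x ∈ S → card S ≡ suc (card (S ∖ x))
  card-∖ {x} x∈S = begin
    card S                                           ≡⟨ ℕ.≤-antisym (card-mono split) (card-mono join) ⟩
    card (⁅ x ⁆ ∪ S ∖ x)                             ≡⟨ sym (ℕ.+-identityʳ _) ⟩
    card (⁅ x ⁆ ∪ S ∖ x) + 0                         ≡⟨ cong (card (⁅ x ⁆ ∪ S ∖ x) +_) (sym (card-empty {S = ⁅ x ⁆ ∩ S ∖ x} disjoint)) ⟩
    card (⁅ x ⁆ ∪ S ∖ x) + card (⁅ x ⁆ ∩ S ∖ x)      ≡⟨ card-∪∩ ⁅ x ⁆ (S ∖ x) ⟩
    card ⁅ x ⁆ + card (S ∖ x)                        ≡⟨ cong (_+ card (S ∖ x)) (card-point x) ⟩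
    suc (card (S ∖ x))                               ∎
    where
    open ≡-Reasoning
    split : S ⊆ ⁅ x ⁆ ∪ S ∖ x
    split {y} y∈S with x Fin.≟ y
    ... | yes refl = ∈∪⁺ˡ ∈⁅⁆
    ... | no  x≢y  = ∈∪⁺ʳ (∈∖⁺ y∈S x≢y)
    join : ⁅ x ⁆ ∪ S ∖ x ⊆ S
    join y∈ with ∈∪⁻ {S = ⁅ x ⁆} y∈
    ... | inj₂ y∈∖ = ∖⊆ y∈∖
    ... | inj₁ y∈x with refl ← ∈⁅⁆⁻ y∈x = x∈S
    disjoint : ∀ {y} → y ∉ ⁅ x ⁆ ∩ S ∖ x
    disjoint y∈ with y∈x , y∈∖ ← ∈∩⁻ {S = ⁅ x ⁆} y∈ with refl ← ∈⁅⁆⁻ y∈x = ∉∖ y∈∖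

card-strict : ∀ {n} {S S′ : Subset n} {x} → S ⊆ S′ → x ∈ S′ → x ∉ S → card S < card S′
card-strict {S = S} {S′} {x} S⊆S′ x∈S′ x∉S = subst (card S <_) (sym (card-∖ x∈S′))
  (s≤s (card-mono (λ y∈S → ∈∖⁺ (S⊆S′ y∈S) (λ { refl → x∉S y∈S }))))

missing : ∀ {n} {S : Subset n} → card S < n → ∃[ x ] x ∉ S
missing {n} {S} <n with x , x∈∁ ← inhabited {S = ∁ S} (ℕ.+-cancelˡ-≤ (card S) 1 _
  (subst₂ _≤_ (ℕ.+-comm 1 (card S)) (sym (card-∁ S)) <n)) = x , ∈∁⁻ x∈∁

two-elements : ∀ {n} {S : Subset n} → 2 ≤ card S → ∃[ x ] ∃[ y ] x ∈ S × y ∈ S × x ≢ y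
two-elements {S = S} 2≤ with x , x∈S ← inhabited (ℕ.<⇒≤ 2≤)
  with y , y∈ ← inhabited {S = S ∖ x} (ℕ.≤-pred (subst (2 ≤_) (card-∖ x∈S) 2≤))
  = x , y , x∈S , ∖⊆ y∈ , λ { refl → ∉∖ {S = S} y∈ }

-- Recursion on n splits off 0: if 0 is missing, downward closure leaves nothing; otherwise the
-- other indices shift down by one. Applied to the positions that a set occupies along a
-- progression, it shows that they form an initial segment.
down-closed : ∀ n (J : ℕ → Bool) → (∀ m → suc m < n → T (J (suc m)) → T (J m)) →
              ∀ m → m < n → T (J m) ⇔ m < card {n} (λ i → J (toℕ i))
down-closed (suc n) J down m m<n = at m m<n
  where
  J′ : ℕ → Bool
  J′ i = J (suc i)
  IH : ∀ m → m < n → T (J′ m) ⇔ m < card {n} (λ i → J′ (toℕ i))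
  IH = down-closed n J′ (λ m m<n → down (suc m) (s≤s m<n))
  J0 : ∀ m → m < suc n → T (J m) → T (J 0)
  J0 zero    _   t = t
  J0 (suc m) m<n t = J0 m (ℕ.<⇒≤ m<n) (down m m<n t)
  at : ∀ m → m < suc n → T (J m) ⇔ m < ind (J 0) + card {n} (λ i → J′ (toℕ i))
  at m m<n with J 0 in eq
  at zero    m<n        | true  = mk⇔ (λ _ → s≤s z≤n) (λ _ → subst T (sym eq) _)
  at (suc m) (s≤s m<n)  | true  = mk⇔ (λ t → s≤s (to (IH m m<n) t)) (λ { (s≤s lt) → from (IH m m<n) lt })
  at m       m<n        | false = mk⇔ (λ t → contradiction (J0 m m<n t) (subst T eq))
    (λ lt → contradiction (inhabited {n} {λ i → J′ (toℕ i)} (ℕ.≤-trans (s≤s z≤n) lt))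
       (λ { (i , mem t) → subst T eq (J0 (suc (toℕ i)) (s≤s (Fin.toℕ<n i)) t) }))

-- Sumsets in a finite abelian group.

module Sumsets {n} {_⊕_ : Fin n → Fin n → Fin n} {ε : Fin n} {⊖_ : Fin n → Fin n}
               (isAbelianGroup : IsAbelianGroup _≡_ _⊕_ ε ⊖_) where

  infixl 6 _⊝_
  infix  8 _·_
  infixl 5 _⊞_

  group : AbelianGroup 0ℓ 0ℓ
  group = record { isAbelianGroup = isAbelianGroup }

  open AbelianGroup group using (assoc; comm; identityʳ)
  open AbelianGroupProperties group
    using (//-rightDividesˡ; //-rightDividesʳ; ⁻¹-involutive; ⁻¹-∙-comm; ε⁻¹≈ε; ∙-cancelˡ; x∙y⁻¹≈ε⇒x≈y)

  _⊝_ : Fin n → Fin n → Fin n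
  x ⊝ y = x ⊕ (⊖ y)

  _·_ : ℕ → Fin n → Fin n
  zero  · d = ε
  suc m · d = d ⊕ (m · d)

  x⊝y⊕y : ∀ x y → (x ⊝ y) ⊕ y ≡ x
  x⊝y⊕y x y = //-rightDividesˡ y x

  x⊕y⊝y : ∀ x y → (x ⊕ y) ⊝ y ≡ x
  x⊕y⊝y x y = //-rightDividesʳ y x

  ⊕-exchange : ∀ x y z → (x ⊕ y) ⊕ z ≡ (x ⊕ z) ⊕ y
  ⊕-exchange x y z = trans (assoc x y z) (trans (cong (x ⊕_) (comm y z)) (sym (assoc x z y)))

  ∈-resp : ∀ {S : Subset n} {x y} → x ≡ y → x ∈ S → y ∈ S
  ∈-resp refl x∈S = x∈S

  shift : Fin n → Subset n → Subset n
  shift t S x = S (x ⊝ t)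

  neg : Subset n → Subset n
  neg S x = S (⊖ x)

  ∈shift⁺ : ∀ {t S x} → x ∈ S → x ⊕ t ∈ shift t S
  ∈shift⁺ {t} {S} {x} x∈S = mem (_∈_.holds (∈-resp {S} (sym (x⊕y⊝y x t)) x∈S))

  ∈shift⁻ : ∀ {t S x} → x ∈ shift t S → x ⊝ t ∈ S
  ∈shift⁻ (mem t) = mem t

  ∈neg⁻ : ∀ {S x} → x ∈ neg S → ⊖ x ∈ S
  ∈neg⁻ (mem t) = mem t

  card-shift : ∀ t S → card (shift t S) ≡ card S
  card-shift t S = card-permute S (_⊝ t) (_⊕ t) (λ x → x⊕y⊝y x t) (λ x → x⊝y⊕y x t)

  card-neg : ∀ S → card (neg S) ≡ card S
  card-neg S = card-permute S ⊖_ ⊖_ ⁻¹-involutive ⁻¹-involutive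

  _⊞_ : Subset n → Subset n → Subset n
  X ⊞ B = ⟪ (λ s → Fin.any? (λ b → (b ∈? B) ×-dec (s ⊝ b ∈? X))) ⟫

  ∈⊞⁺ : ∀ {X B x b} → x ∈ X → b ∈ B → x ⊕ b ∈ X ⊞ B
  ∈⊞⁺ {X} {B} {x} {b} x∈X b∈B = ∈⟪⟫⁺ {P? = λ s → Fin.any? (λ b → (b ∈? B) ×-dec (s ⊝ b ∈? X))}
    (b , b∈B , ∈-resp (sym (x⊕y⊝y x b)) x∈X)

  ∈⊞⁻ : ∀ {X B s} → s ∈ X ⊞ B → ∃[ x ] ∃[ b ] x ∈ X × b ∈ B × s ≡ x ⊕ b
  ∈⊞⁻ {X} {B} {s} s∈ with b , b∈B , s-b∈X ← ∈⟪⟫⁻ {P? = λ s → Fin.any? (λ b → (b ∈? B) ×-dec (s ⊝ b ∈? X))} s∈ =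
    s ⊝ b , b , s-b∈X , b∈B , sym (x⊝y⊕y s b)

  ⊞-mono : ∀ {X X′ B B′} → X ⊆ X′ → B ⊆ B′ → X ⊞ B ⊆ X′ ⊞ B′
  ⊞-mono X⊆ B⊆ s∈ with x , b , x∈X , b∈B , refl ← ∈⊞⁻ s∈ = ∈⊞⁺ (X⊆ x∈X) (B⊆ b∈B)

  ⊞-comm : ∀ {X B} → X ⊞ B ⊆ B ⊞ X
  ⊞-comm s∈ with x , b , x∈X , b∈B , refl ← ∈⊞⁻ s∈ = ∈-resp (comm b x) (∈⊞⁺ b∈B x∈X)

  shift⊆⊞ : ∀ {X B b} → b ∈ B → shift b X ⊆ X ⊞ B
  shift⊆⊞ {b = b} b∈B {x} x∈ = ∈-resp (x⊝y⊕y x b) (∈⊞⁺ (∈shift⁻ x∈) b∈B)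

  card≤⊞ : ∀ {X B} → 1 ≤ card B → card X ≤ card (X ⊞ B)
  card≤⊞ {X} {B} 1≤B with b , b∈B ← inhabited {S = B} 1≤B =
    subst (_≤ card (X ⊞ B)) (card-shift b X) (card-mono (shift⊆⊞ b∈B))

  shift-⊞ : ∀ {t X B} → shift t X ⊞ B ⊆ shift t (X ⊞ B)
  shift-⊞ {t} {X} {B} s∈ with x , b , x∈ , b∈B , refl ← ∈⊞⁻ s∈ =
    ∈-resp (trans (⊕-exchange (x ⊝ t) b t) (cong (_⊕ b) (x⊝y⊕y x t)))
         (∈shift⁺ {S = X ⊞ B} (∈⊞⁺ (∈shift⁻ x∈) b∈B))

  ∩-⊞ : ∀ {X X′ B} → (X ∩ X′) ⊞ B ⊆ (X ⊞ B) ∩ (X′ ⊞ B)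
  ∩-⊞ {X} s∈ with x , b , x∈ , b∈B , refl ← ∈⊞⁻ s∈ with x∈X , x∈X′ ← ∈∩⁻ {S = X} x∈ =
    ∈∩⁺ (∈⊞⁺ x∈X b∈B) (∈⊞⁺ x∈X′ b∈B)

  ∪-⊞ : ∀ {X X′ B} → (X ∪ X′) ⊞ B ⊆ (X ⊞ B) ∪ (X′ ⊞ B)
  ∪-⊞ {X} s∈ with x , b , x∈ , b∈B , refl ← ∈⊞⁻ s∈ with ∈∪⁻ {S = X} x∈
  ... | inj₁ x∈X  = ∈∪⁺ˡ (∈⊞⁺ x∈X b∈B)
  ... | inj₂ x∈X′ = ∈∪⁺ʳ (∈⊞⁺ x∈X′ b∈B)

  -- The Cauchy-Davenport inequality.

  module _ (discreteLog : ∀ {d} → d ≢ ε → ∃ λ (log : Fin n → Fin n) → (∀ y → toℕ (log y) · d ≡ y) × (∀ i → log (toℕ i · d) ≡ i)) where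

    -- If X were closed under adding d, it would contain x + m d for all m, which is every element
    -- because d generates the group.
    exit : ∀ {X d} → d ≢ ε → 1 ≤ card X → card X < n → ∃[ x ] x ∈ X × x ⊕ d ∉ X
    exit {X} {d} d≢ε 1≤X X<n with Fin.any? (λ x → (x ∈? X) ×-dec ¬? (x ⊕ d ∈? X))
    ... | yes e = e
    ... | no ¬e with x , x∈X ← inhabited {S = X} 1≤X | z , z∉X ← missing {S = X} X<n | log , log· , _ ← discreteLog d≢ε =
      contradiction (∈-resp (trans (cong (x ⊕_) (log· (z ⊝ x))) (trans (comm x (z ⊝ x)) (x⊝y⊕y z x)))
                          (orbit (toℕ (log (z ⊝ x))))) z∉X
      where
      orbit : ∀ m → x ⊕ (m · d) ∈ X
      orbit zero    = ∈-resp (sym (identityʳ x)) x∈X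
      orbit (suc m) = ∈-resp (trans (assoc x (m · d) d) (cong (x ⊕_) (comm (m · d) d)))
        (decidable-stable (_ ∈? X) (λ ∉X → ¬e (x ⊕ (m · d) , orbit m , ∉X)))

    -- The Davenport–Dyson e-transform: X grows by what B loses.
    transform : ∀ {X B} → 1 ≤ card X → card X < n → 2 ≤ card B →
      ∃[ X′ ] ∃[ B′ ] 1 ≤ card X′ × 1 ≤ card B′ × card B′ < card B ×
        card X′ + card B′ ≡ card X + card B × X′ ⊞ B′ ⊆ X ⊞ B
    transform {X} {B} 1≤X X<n 2≤B
      with b₀ , b , b₀∈B , b∈B , b₀≢b ← two-elements {S = B} 2≤B
      with x , x∈X , x+d∉X ← exit {d = b ⊝ b₀} (λ eq → b₀≢b (sym (x∙y⁻¹≈ε⇒x≈y b b₀ eq))) 1≤X X<n =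
      X ∪ shift e B , B′ , ℕ.≤-trans 1≤X (card-mono {S = X} ∈∪⁺ˡ) , ℕ.≤-trans (ℕ.≤-reflexive (sym (card-point b₀))) (card-mono point⊆)
      , card-strict (λ y∈ → proj₁ (∈∩⁻ y∈)) b∈B b∉B′
      , trans (cong (card (X ∪ shift e B) +_) B′≡) (trans (card-∪∩ X (shift e B)) (cong (card X +_) (card-shift e B)))
      , sub
      where
      -- This translation takes b₀ to x, which lies in X, and b to x + (b - b₀), which does not. So
      -- b₀ stays in `B′` and b is lost.
      e : Fin n
      e = x ⊝ b₀
      B′ : Subset n
      B′ = B ∩ (λ y → X (y ⊕ e))
      b₀+e : b₀ ⊕ e ≡ x
      b₀+e = trans (comm b₀ e) (x⊝y⊕y x b₀)
      b+e : b ⊕ e ≡ x ⊕ (b ⊝ b₀)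
      b+e = trans (comm b e) (trans (assoc x (⊖ b₀) b) (cong (x ⊕_) (comm (⊖ b₀) b)))
      point⊆ : ⁅ b₀ ⁆ ⊆ B′
      point⊆ y∈ with refl ← ∈⁅⁆⁻ y∈ = ∈∩⁺ b₀∈B (mem (_∈_.holds (∈-resp {X} (sym b₀+e) x∈X)))
      b∉B′ : b ∉ B′
      b∉B′ b∈ with mem t ← proj₂ (∈∩⁻ {S = B} b∈) = x+d∉X (∈-resp {X} b+e (mem t))
      B′≡ : card B′ ≡ card (X ∩ shift e B)
      B′≡ = trans (sym (card-shift e B′)) (ℕ.≤-antisym
        (card-mono {S = shift e B′} {X ∩ shift e B} (λ {y} y∈ → let y∈B , y∈X = ∈∩⁻ {S = B} (∈shift⁻ {S = B′} y∈) in
          ∈∩⁺ (∈-resp {X} (x⊝y⊕y y e) (mem (_∈_.holds y∈X))) (mem (_∈_.holds y∈B))))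
        (card-mono {S = X ∩ shift e B} {shift e B′} (λ {y} y∈ → let y∈X , y∈B = ∈∩⁻ {S = X} y∈ in
          mem (_∈_.holds (∈∩⁺ {S = B} {λ y → X (y ⊕ e)} {y ⊝ e} (∈shift⁻ y∈B) (mem (_∈_.holds (∈-resp {X} (sym (x⊝y⊕y y e)) y∈X))))))))
      sub : (X ∪ shift e B) ⊞ B′ ⊆ X ⊞ B
      sub s∈ with u , v , u∈ , v∈ , refl ← ∈⊞⁻ s∈ with v∈B , mem v+e∈X ← ∈∩⁻ {S = B} v∈ with ∈∪⁻ {S = X} u∈
      ... | inj₁ u∈X = ∈⊞⁺ u∈X v∈B
      -- With u = w + e for some w in B, the sum u + v is regrouped as (v + e) + w, where v + e lies
      -- in X.
      ... | inj₂ u∈  = ∈-resp (trans (⊕-exchange v e (u ⊝ e)) (trans (assoc v (u ⊝ e) e) (trans (cong (v ⊕_) (x⊝y⊕y u e)) (comm v u))))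
                         (∈⊞⁺ {X} (mem v+e∈X) (∈shift⁻ u∈))

    -- Each `transform` keeps |X| + |B|, does not enlarge the sumset and shrinks B. Once |B| = 1,
    -- the claim is |X| ≤ |X ⊞ B|.
    cauchy-davenport : ∀ {X B} → 1 ≤ card X → 1 ≤ card B → card (X ⊞ B) < n → card X + card B ≤ suc (card (X ⊞ B))
    cauchy-davenport {X} {B} 1≤X 1≤B <n = go X B (<-wellFounded (card B)) 1≤X 1≤B <n
      where
      go : ∀ X B → Acc _<_ (card B) → 1 ≤ card X → 1 ≤ card B → card (X ⊞ B) < n → card X + card B ≤ suc (card (X ⊞ B))
      go X B (acc rs) 1≤X 1≤B <n with 2 ℕ.≤? card B
      ... | no ≱2 = subst (card X + card B ≤_) (ℕ.+-comm (card (X ⊞ B)) 1)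
                      (ℕ.+-mono-≤ (card≤⊞ {X} {B} 1≤B) (ℕ.≤-pred (ℕ.≰⇒> ≱2)))
      ... | yes 2≤B = let X′ , B′ , 1≤X′ , 1≤B′ , B′<B , same , sub = transform {X} {B} 1≤X (ℕ.≤-<-trans (card≤⊞ {X} {B} 1≤B) <n) 2≤B
                          le = card-mono {S = X′ ⊞ B′} {X ⊞ B} sub in
        subst (_≤ suc (card (X ⊞ B))) same
          (ℕ.≤-trans (go X′ B′ (rs B′<B) 1≤X′ 1≤B′ (ℕ.≤-<-trans le <n)) (s≤s le))

    -- Critical pairs, duality and submodularity.

    record Critical (X B : Subset n) : Set where
      constructor critical
      field
        2≤X   : 2 ≤ card X
        -- The two elements outside the sumset supply two elements of the dual set. For nonempty B,
        -- Cauchy-Davenport and `small` together force |X ⊞ B| = |X| + |B| - 1.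
        2+≤n  : 2 + card (X ⊞ B) ≤ n
        small : card (X ⊞ B) < card X + card B

    open Critical

    critical-comm : ∀ {X B} → 2 ≤ card B → Critical X B → Critical B X
    critical-comm {X} {B} 2≤B c = critical 2≤B
      (ℕ.≤-trans (s≤s (s≤s le)) (2+≤n c))
      (subst (card (B ⊞ X) <_) (ℕ.+-comm (card X) (card B)) (ℕ.≤-<-trans le (small c)))
      where
      le : card (B ⊞ X) ≤ card (X ⊞ B)
      le = card-mono {S = B ⊞ X} {X ⊞ B} (⊞-comm {B} {X})

    -- The complement of X ⊞ B is naturally paired with -B; negating it gives a partner for B
    -- itself.
    dual : Subset n → Subset n → Subset n
    dual X B = neg (∁ (X ⊞ B))

    card-dual : ∀ X B → card (dual X B) + card (X ⊞ B) ≡ n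
    card-dual X B = trans (cong (_+ card (X ⊞ B)) (card-neg (∁ (X ⊞ B))))
      (trans (ℕ.+-comm (card (∁ (X ⊞ B))) (card (X ⊞ B))) (card-∁ (X ⊞ B)))

    -- If y + b = -x with x in X, then -y = x + b would lie in X ⊞ B.
    dual-⊞ : ∀ {X B} → dual X B ⊞ B ⊆ neg (∁ X)
    dual-⊞ {X} {B} s∈ with y , b , y∈ , b∈B , refl ← ∈⊞⁻ {dual X B} {B} s∈ =
      mem (_∈_.holds (∈∁⁺ {S = X} {⊖ (y ⊕ b)} (λ x∈X → ∈∁⁻ {S = X ⊞ B} (∈neg⁻ {∁ (X ⊞ B)} y∈)
        (∈-resp {X ⊞ B} (trans (cong (_⊕ b) (sym (⁻¹-∙-comm y b))) (x⊝y⊕y (⊖ y) b)) (∈⊞⁺ {X} {B} x∈X b∈B)))))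

    -- The dual has n - |X ⊞ B| elements and its sumset with B at most n - |X|, so the excess of the
    -- sumset over the set does not grow. The lower bound on |X| and the room outside X ⊞ B change
    -- places.
    dual-critical : ∀ {X B} → Critical X B → Critical (dual X B) B
    dual-critical {X} {B} c = critical
      (ℕ.+-cancelʳ-≤ Q 2 y (subst (2 + Q ≤_) (sym y+Q) (2+≤n c)))
      (ℕ.≤-trans (subst (_≤ z + x) (ℕ.+-comm z 2) (ℕ.+-monoʳ-≤ z (2≤X c))) z+x≤n)
      (ℕ.+-cancelʳ-< x z (y + b) (ℕ.≤-<-trans z+x≤n (subst₂ _<_ y+Q (lem y x b) (ℕ.+-monoʳ-< y (small c)))))
      where
      x b y z Q : ℕ
      x = card X
      b = card B
      y = card (dual X B)
      z = card (dual X B ⊞ B)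
      Q = card (X ⊞ B)
      y+Q : y + Q ≡ n
      y+Q = card-dual X B
      z+x≤n : z + x ≤ n
      z+x≤n = subst (z + x ≤_) (trans (ℕ.+-comm (card (∁ X)) x) (card-∁ X))
        (ℕ.+-monoˡ-≤ x (subst (z ≤_) (card-neg (∁ X)) (card-mono {S = dual X B ⊞ B} {neg (∁ X)} (dual-⊞ {X} {B}))))
      lem : ∀ y x b → y + (x + b) ≡ y + b + x
      lem = solve-∀

    -- Submodularity of X ↦ |X ⊞ B|; the bound on |X ⊞ B| keeps Cauchy–Davenport
    -- available for the union.
    ∩-critical : ∀ {X B t} → Critical X B → 1 ≤ card B → card X + card (X ⊞ B) ≤ n →
                 2 ≤ card (X ∩ shift t X) → Critical (X ∩ shift t X) B
    ∩-critical {X} {B} {t} c 1≤B x+Q≤n 2≤Z = critical 2≤Z (ℕ.≤-trans (s≤s (s≤s zz≤Q)) (2+≤n c))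
        (ℕ.+-cancelʳ-≤ (v + b) (suc zz) (w + b) (begin
          suc zz + (v + b)    ≤⟨ ℕ.+-monoʳ-≤ (suc zz) v+b≤1+uu ⟩
          suc zz + suc uu     ≡⟨ lem₁ zz uu ⟩
          2 + (zz + uu)       ≤⟨ ℕ.+-monoʳ-≤ 2 zz+uu≤2Q ⟩
          2 + (Q + Q)         ≡⟨ lem₂ Q ⟩
          suc Q + suc Q       ≤⟨ ℕ.+-mono-≤ (small c) (small c) ⟩
          x + b + (x + b)     ≡⟨ lem₃ x b ⟩
          x + x + (b + b)     ≡⟨ cong (_+ (b + b)) (sym v+w) ⟩
          v + w + (b + b)     ≡⟨ lem₄ v w b ⟩
          w + b + (v + b)     ∎))
      where
      open ℕ.≤-Reasoning
      Z U : Subset n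
      Z = X ∩ shift t X
      U = X ∪ shift t X
      x b w v zz uu Q : ℕ
      x = card X
      b = card B
      w = card Z
      v = card U
      zz = card (Z ⊞ B)
      uu = card (U ⊞ B)
      Q = card (X ⊞ B)
      S : Subset n
      S = shift t X ⊞ B
      S≤Q : card S ≤ Q
      S≤Q = subst (card S ≤_) (card-shift t (X ⊞ B)) (card-mono {S = S} {shift t (X ⊞ B)} (shift-⊞ {t} {X} {B}))
      v+w : v + w ≡ x + x
      v+w = trans (card-∪∩ X (shift t X)) (cong (x +_) (card-shift t X))
      zz≤ : zz ≤ card ((X ⊞ B) ∩ S)
      zz≤ = card-mono {S = Z ⊞ B} {(X ⊞ B) ∩ S} (∩-⊞ {X} {shift t X} {B})
      zz≤Q : zz ≤ Q
      zz≤Q = ℕ.≤-trans zz≤ (card-mono {S = (X ⊞ B) ∩ S} {X ⊞ B} (λ s∈ → proj₁ (∈∩⁻ {S = X ⊞ B} {S} s∈)))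
      zz+uu≤2Q : zz + uu ≤ Q + Q
      zz+uu≤2Q = begin
        zz + uu                                       ≤⟨ ℕ.+-mono-≤ zz≤ (card-mono {S = U ⊞ B} {(X ⊞ B) ∪ S} (∪-⊞ {X} {shift t X} {B})) ⟩
        card ((X ⊞ B) ∩ S) + card ((X ⊞ B) ∪ S)       ≡⟨ ℕ.+-comm (card ((X ⊞ B) ∩ S)) _ ⟩
        card ((X ⊞ B) ∪ S) + card ((X ⊞ B) ∩ S)       ≡⟨ card-∪∩ (X ⊞ B) S ⟩
        Q + card S                                    ≤⟨ ℕ.+-monoʳ-≤ Q S≤Q ⟩
        Q + Q                                         ∎
      Q<n : Q < n
      Q<n = ℕ.<-trans ℕ.≤-refl (2+≤n c)
      w+b≤1+zz : w + b ≤ suc zz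
      w+b≤1+zz = cauchy-davenport {Z} {B} (ℕ.<⇒≤ 2≤Z) 1≤B (ℕ.≤-<-trans zz≤Q Q<n)
      -- Cauchy-Davenport for the intersection, with 2 ≤ w, gives zz ≥ b + 1. Submodularity, `small`
      -- and x + Q ≤ n then keep uu below n.
      uu<n : uu < n
      uu<n = ℕ.+-cancelʳ-≤ (1 + b) (suc uu) n (begin
        suc uu + (1 + b)        ≡⟨ lem₅ uu b ⟩
        uu + (2 + b)            ≤⟨ ℕ.+-monoʳ-≤ uu (ℕ.+-monoˡ-≤ b 2≤Z) ⟩
        uu + (w + b)            ≤⟨ ℕ.+-monoʳ-≤ uu w+b≤1+zz ⟩
        uu + suc zz             ≡⟨ lem₆ uu zz ⟩
        suc (zz + uu)           ≤⟨ s≤s zz+uu≤2Q ⟩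
        suc (Q + Q)             ≡⟨ sym (ℕ.+-suc Q Q) ⟩
        Q + suc Q               ≤⟨ ℕ.+-monoʳ-≤ Q (small c) ⟩
        Q + (x + b)             ≡⟨ lem₇ Q x b ⟩
        (x + Q) + b             ≤⟨ ℕ.+-monoˡ-≤ b x+Q≤n ⟩
        n + b                   ≤⟨ ℕ.+-monoʳ-≤ n (ℕ.n≤1+n b) ⟩
        n + (1 + b)             ∎)
        where
        lem₅ : ∀ u b → suc u + (1 + b) ≡ u + (2 + b)
        lem₅ u b = sym (ℕ.+-suc u (suc b))
        lem₆ : ∀ u z → u + suc z ≡ suc (z + u)
        lem₆ u z = trans (ℕ.+-suc u z) (cong suc (ℕ.+-comm u z))
        lem₇ : ∀ Q x b → Q + (x + b) ≡ x + Q + b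
        lem₇ = solve-∀
      v+b≤1+uu : v + b ≤ suc uu
      v+b≤1+uu = cauchy-davenport {U} {B}
        (ℕ.≤-trans (ℕ.<⇒≤ (2≤X c)) (card-mono {S = X} {U} (∈∪⁺ˡ {S = X}))) 1≤B uu<n
      lem₁ : ∀ z u → suc z + suc u ≡ 2 + (z + u)
      lem₁ z u = cong suc (ℕ.+-suc z u)
      lem₂ : ∀ Q → 2 + (Q + Q) ≡ suc Q + suc Q
      lem₂ Q = cong suc (sym (ℕ.+-suc Q Q))
      lem₃ : ∀ x b → x + b + (x + b) ≡ x + x + (b + b)
      lem₃ = solve-∀
      lem₄ : ∀ v w b → v + w + (b + b) ≡ w + b + (v + b)
      lem₄ = solve-∀

    -- Sidon sets and minimal critical sets.

    Sidon : Subset n → Set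
    Sidon X = ∀ t → t ≢ ε → card (X ∩ shift t X) ≤ 1

    ∩-shift-strict : ∀ {X t} → t ≢ ε → 1 ≤ card X → card X < n → card (X ∩ shift t X) < card X
    ∩-shift-strict {X} {t} t≢ε 1≤X X<n =
      let x , x∈X , x-t∉X = exit {X} {⊖ t} (λ eq → t≢ε (trans (sym (⁻¹-involutive t)) (trans (cong ⊖_ eq) ε⁻¹≈ε))) 1≤X X<n in
      card-strict {S = X ∩ shift t X} {X} (λ s∈ → proj₁ (∈∩⁻ {S = X} s∈)) x∈X
        (λ x∈ → x-t∉X (∈shift⁻ {t} {X} (proj₂ (∈∩⁻ {S = X} {shift t X} x∈))))

    -- A minimal critical set meets its proper translates in at most one point:
    -- otherwise X ∩ (X + t), or the dual of X if that is smaller, is a smaller critical set.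
    atom : ∀ {X B} → 1 ≤ card B → Critical X B → ∃[ X′ ] Critical X′ B × Sidon X′
    atom {X} {B} 1≤B c = go X (<-wellFounded (card X)) c
      where
      go : ∀ X → Acc _<_ (card X) → Critical X B → ∃[ X′ ] Critical X′ B × Sidon X′
      go X (acc rs) c with card (dual X B) ℕ.<? card X
      ... | yes smaller = go (dual X B) (rs smaller) (dual-critical {X} {B} c)
      ... | no  ≮ with Fin.any? (λ t → ¬? (t Fin.≟ ε) ×-dec (2 ℕ.≤? card (X ∩ shift t X)))
      ...   | no ¬∃ = X , c , λ t t≢ε → ℕ.≤-pred (ℕ.≰⇒> (λ 2≤ → ¬∃ (t , t≢ε , 2≤)))
      ...   | yes (t , t≢ε , 2≤) = go (X ∩ shift t X)
              (rs (∩-shift-strict {X} {t} t≢ε (ℕ.<⇒≤ (2≤X c)) X<n))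
              (∩-critical {X} {B} {t} c 1≤B x+Q≤n 2≤)
        where
        -- The dual is at least as large as X in this case, and it has n - |X ⊞ B| elements.
        x+Q≤n : card X + card (X ⊞ B) ≤ n
        x+Q≤n = subst (card X + card (X ⊞ B) ≤_) (card-dual X B) (ℕ.+-monoˡ-≤ (card (X ⊞ B)) (ℕ.≮⇒≥ ≮))
        X<n : card X < n
        X<n = ℕ.≤-<-trans (card≤⊞ {X} {B} 1≤B) (ℕ.<-trans ℕ.≤-refl (2+≤n c))

    ⊝-chain : ∀ s y z → (s ⊝ y) ⊝ (z ⊝ y) ≡ s ⊝ z
    ⊝-chain s y z = trans (cong (_⊝ (z ⊝ y)) (sym (trans (sym (assoc (s ⊝ z) z (⊖ y))) (cong (_⊝ y) (x⊝y⊕y s z)))))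
                          (x⊕y⊝y (s ⊝ z) (z ⊝ y))

    sidon-translates : ∀ {X y z} → Sidon X → y ≢ z → card (shift y X ∩ shift z X) ≤ 1
    sidon-translates {X} {y} {z} sidon y≢z =
      ℕ.≤-trans (subst (card (shift y X ∩ shift z X) ≤_) (card-shift y T′) (card-mono {S = shift y X ∩ shift z X} {shift y T′} sub))
                (sidon (z ⊝ y) (λ eq → y≢z (sym (x∙y⁻¹≈ε⇒x≈y z y eq))))
      where
      T′ : Subset n
      T′ = X ∩ shift (z ⊝ y) X
      sub : shift y X ∩ shift z X ⊆ shift y T′
      sub {s} s∈ = let s∈y , s∈z = ∈∩⁻ {S = shift y X} {shift z X} s∈ in
        mem (_∈_.holds (∈∩⁺ {S = X} {shift (z ⊝ y) X} (∈shift⁻ {y} {X} s∈y)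
          (mem (_∈_.holds (∈-resp {X} (sym (⊝-chain s y z)) (∈shift⁻ {z} {X} s∈z))))))

    card-∪-≤ : ∀ (S S′ : Subset n) → card (S ∪ S′) ≤ card S + card S′
    card-∪-≤ S S′ = subst (card (S ∪ S′) ≤_) (card-∪∩ S S′) (ℕ.m≤m+n _ _)

    -- X ⊞ Y is a union of |Y| translates of X, each of which meets the further translate by y in at
    -- most one point.
    sidon-overlap : ∀ {X y} → Sidon X → ∀ m Y → card Y ≡ m → y ∉ Y → card (shift y X ∩ (X ⊞ Y)) ≤ m
    sidon-overlap {X} {y} sidon zero Y Y≡ y∉Y = ℕ.≤-reflexive (card-empty {S = shift y X ∩ (X ⊞ Y)} none)
      where
      none : ∀ {s} → s ∉ shift y X ∩ (X ⊞ Y)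
      none s∈ = let _ , b , _ , b∈Y , _ = ∈⊞⁻ {X} {Y} (proj₂ (∈∩⁻ {S = shift y X} {X ⊞ Y} s∈)) in
        ℕ.0≢1+n (trans (sym Y≡) (card-∖ {S = Y} b∈Y))
    sidon-overlap {X} {y} sidon (suc m) Y Y≡ y∉Y =
      let z , z∈Y = inhabited {S = Y} (subst (1 ≤_) (sym Y≡) (s≤s z≤n)) in
      bound z z∈Y
      where
      bound : ∀ z → z ∈ Y → card (shift y X ∩ (X ⊞ Y)) ≤ suc m
      bound z z∈Y = begin
        card (shift y X ∩ (X ⊞ Y))                                       ≤⟨ card-mono {S = shift y X ∩ (X ⊞ Y)} {I ∪ I′} split ⟩
        card (I ∪ I′)                                                    ≤⟨ card-∪-≤ I I′ ⟩
        card I + card I′                                                 ≤⟨ ℕ.+-mono-≤ (sidon-overlap {X} {y} sidon m (Y ∖ z) Y∖z≡ (λ y∈ → y∉Y (∖⊆ {S = Y} y∈)))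
                                                                                       (sidon-translates {X} {y} {z} sidon (λ { refl → y∉Y z∈Y })) ⟩
        m + 1                                                            ≡⟨ ℕ.+-comm m 1 ⟩
        suc m                                                            ∎
        where
        open ℕ.≤-Reasoning
        I I′ : Subset n
        I = shift y X ∩ (X ⊞ (Y ∖ z))
        I′ = shift y X ∩ shift z X
        Y∖z≡ : card (Y ∖ z) ≡ m
        Y∖z≡ = ℕ.suc-injective (trans (sym (card-∖ {S = Y} z∈Y)) Y≡)
        split : shift y X ∩ (X ⊞ Y) ⊆ I ∪ I′
        split {s} s∈ = let s∈y , s∈⊞ = ∈∩⁻ {S = shift y X} {X ⊞ Y} s∈
                           x , b , x∈X , b∈Y , s≡ = ∈⊞⁻ {X} {Y} s∈⊞ in
          case′ x b x∈X b∈Y s≡ s∈y (z Fin.≟ b)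
          where
          case′ : ∀ x b → x ∈ X → b ∈ Y → s ≡ x ⊕ b → s ∈ shift y X → Dec (z ≡ b) → s ∈ I ∪ I′
          case′ x b x∈X b∈Y refl s∈y (yes refl) = ∈∪⁺ʳ {S = I} {I′} (∈∩⁺ {S = shift y X} {shift z X} s∈y (∈shift⁺ {z} {X} x∈X))
          case′ x b x∈X b∈Y refl s∈y (no z≢b)   = ∈∪⁺ˡ {S = I} {I′} (∈∩⁺ {S = shift y X} {X ⊞ (Y ∖ z)} s∈y (∈⊞⁺ {X} {Y ∖ z} x∈X (∈∖⁺ {S = Y} b∈Y z≢b)))

    -- By `sidon-overlap` the translate X + y contributes at least |X| - |Y ∖ y| elements outside X
    -- ⊞ (Y ∖ y).
    sidon-step : ∀ {X Y y} → Sidon X → y ∈ Y →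
                 card (X ⊞ (Y ∖ y)) + card X ≤ card (X ⊞ Y) + card (Y ∖ y)
    sidon-step {X} {Y} {y} sidon y∈Y = begin
      card (X ⊞ Y′) + card X                                         ≡⟨ cong (card (X ⊞ Y′) +_) (sym (card-shift y X)) ⟩
      card (X ⊞ Y′) + card (shift y X)                               ≡⟨ ℕ.+-comm (card (X ⊞ Y′)) _ ⟩
      card (shift y X) + card (X ⊞ Y′)                               ≡⟨ sym (card-∪∩ (shift y X) (X ⊞ Y′)) ⟩
      card (shift y X ∪ (X ⊞ Y′)) + card (shift y X ∩ (X ⊞ Y′))      ≤⟨ ℕ.+-mono-≤ (card-mono {S = shift y X ∪ (X ⊞ Y′)} {X ⊞ Y} sub)
                                                                          (sidon-overlap {X} {y} sidon (card Y′) Y′ refl (∉∖ {S = Y})) ⟩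
      card (X ⊞ Y) + card Y′                                         ∎
      where
      open ℕ.≤-Reasoning
      Y′ : Subset n
      Y′ = Y ∖ y
      sub : shift y X ∪ (X ⊞ Y′) ⊆ X ⊞ Y
      sub s∈ = [ shift⊆⊞ {X} {Y} y∈Y , ⊞-mono {X} {X} {Y′} {Y} (λ x∈ → x∈) (∖⊆ {S = Y}) ]′ (∈∪⁻ {S = shift y X} {X ⊞ Y′} s∈)

    -- When the elements of Y are added in turn, the first two translates supply at least |X| and
    -- |X| - 1 elements; each later one supplies at least one new element because |Y| ≤ |X|.
    sidon-⊞ : ∀ {X} → Sidon X → ∀ m Y → card Y ≡ 2 + m → 2 + m ≤ card X → card X + card X + m ≤ suc (card (X ⊞ Y))
    sidon-⊞ {X} sidon m Y Y≡ le =
      let y , y∈Y = inhabited {S = Y} (subst (1 ≤_) (sym Y≡) (s≤s z≤n)) in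
      at m Y≡ le y y∈Y
      where
      open ℕ.≤-Reasoning
      at : ∀ m → card Y ≡ 2 + m → 2 + m ≤ card X → ∀ y → y ∈ Y → card X + card X + m ≤ suc (card (X ⊞ Y))
      at zero Y≡ le y y∈Y = begin
        card X + card X + 0                ≡⟨ ℕ.+-identityʳ _ ⟩
        card X + card X                    ≤⟨ ℕ.+-monoˡ-≤ (card X) (card≤⊞ {X} {Y ∖ y} (ℕ.≤-reflexive (sym Y∖y≡))) ⟩
        card (X ⊞ (Y ∖ y)) + card X        ≤⟨ sidon-step {X} {Y} sidon y∈Y ⟩
        card (X ⊞ Y) + card (Y ∖ y)        ≡⟨ cong (card (X ⊞ Y) +_) Y∖y≡ ⟩
        card (X ⊞ Y) + 1                   ≡⟨ ℕ.+-comm (card (X ⊞ Y)) 1 ⟩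
        suc (card (X ⊞ Y))                 ∎
        where
        Y∖y≡ : card (Y ∖ y) ≡ 1
        Y∖y≡ = ℕ.suc-injective (trans (sym (card-∖ {S = Y} y∈Y)) Y≡)
      at (suc m) Y≡ le y y∈Y = ℕ.+-cancelʳ-≤ (q + x + (2 + m)) (x + x + suc m) (suc Q) (begin
        x + x + suc m + (q + x + (2 + m))       ≡⟨ lem₁ x m q ⟩
        x + x + m + (q + x) + (3 + m)           ≤⟨ ℕ.+-mono-≤ (ℕ.+-mono-≤ IH step) le ⟩
        suc q + (Q + (2 + m)) + x               ≡⟨ lem₂ q Q m x ⟩
        suc Q + (q + x + (2 + m))               ∎)
        where
        x q Q : ℕ
        x = card X
        q = card (X ⊞ (Y ∖ y))
        Q = card (X ⊞ Y)
        Y∖y≡ : card (Y ∖ y) ≡ 2 + m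
        Y∖y≡ = ℕ.suc-injective (trans (sym (card-∖ {S = Y} y∈Y)) Y≡)
        IH : x + x + m ≤ suc q
        IH = sidon-⊞ {X} sidon m (Y ∖ y) Y∖y≡ (ℕ.<⇒≤ le)
        step : q + x ≤ Q + (2 + m)
        step = subst (λ c → q + x ≤ Q + c) Y∖y≡ (sidon-step {X} {Y} sidon y∈Y)
        lem₁ : ∀ x m q → x + x + (1 + m) + (q + x + (2 + m)) ≡ x + x + m + (q + x) + (3 + m)
        lem₁ = solve-∀
        lem₂ : ∀ q Q m x → 1 + q + (Q + (2 + m)) + x ≡ 1 + Q + (q + x + (2 + m))
        lem₂ = solve-∀

    -- `sidon-⊞` gives 2|X| + |Y| - 2 ≤ |X ⊞ Y| + 1, while criticality gives |X ⊞ Y| + 1 ≤ |X| +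
    -- |Y|.
    sidon-critical : ∀ {X Y} → Sidon X → Critical X Y → 2 ≤ card Y → card Y ≤ card X → card X ≤ 2
    sidon-critical {X} {Y} sidon c 2≤Y Y≤X = ℕ.+-cancelʳ-≤ (x + m) x 2 (begin
      x + (x + m)         ≡⟨ sym (ℕ.+-assoc x x m) ⟩
      x + x + m           ≤⟨ sidon-⊞ {X} sidon m Y (sym 2+m≡) (subst (_≤ x) (sym 2+m≡) Y≤X) ⟩
      suc (card (X ⊞ Y))  ≤⟨ small c ⟩
      x + card Y          ≡⟨ cong (x +_) (sym 2+m≡) ⟩
      x + (2 + m)         ≡⟨ lem x m ⟩
      2 + (x + m)         ∎)
      where
      open ℕ.≤-Reasoning
      x m : ℕ
      x = card X
      m = card Y ∸ 2
      2+m≡ : 2 + m ≡ card Y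
      2+m≡ = ℕ.m+[n∸m]≡n 2≤Y
      lem : ∀ x m → x + (2 + m) ≡ 2 + (x + m)
      lem = solve-∀

    -- Criticality is symmetric, so an atom X₁ for B makes B critical for X₁, which yields an atom Y
    -- for X₁. Both are Sidon sets; the larger one has at most two elements by `sidon-critical`,
    -- hence so does X₁.
    critical-pair : ∀ {X B} → 2 ≤ card B → Critical X B → ∃[ X′ ] Critical X′ B × card X′ ≤ 2
    critical-pair {X} {B} 2≤B c =
      let X₁ , c₁ , sidon₁ = atom {X} {B} (ℕ.<⇒≤ 2≤B) c
          Y , cY , sidonY = atom {B} {X₁} (ℕ.<⇒≤ (2≤X c₁)) (critical-comm {X₁} {B} 2≤B c₁)
      in X₁ , c₁ , bound X₁ Y (2≤X c₁) sidon₁ cY sidonY (ℕ.≤-total (card Y) (card X₁))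
      where
      bound : ∀ X₁ Y → 2 ≤ card X₁ → Sidon X₁ → Critical Y X₁ → Sidon Y → card Y ≤ card X₁ ⊎ card X₁ ≤ card Y → card X₁ ≤ 2
      bound X₁ Y 2≤X₁ sidon₁ cY sidonY (inj₁ Y≤X₁) = sidon-critical {X₁} {Y} sidon₁ (critical-comm {Y} {X₁} 2≤X₁ cY) (2≤X cY) Y≤X₁
      bound X₁ Y 2≤X₁ sidon₁ cY sidonY (inj₂ X₁≤Y) = ℕ.≤-trans X₁≤Y (sidon-critical {Y} {X₁} sidonY cY 2≤X₁ X₁≤Y)

    -- Vosper's theorem.

    Progression : Subset n → Set
    Progression B = ∃[ b₀ ] ∃[ d ] ∀ s → s ∈ B ⇔ (∃[ i ] (i < card B × s ≡ b₀ ⊕ (i · d)))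

    -- B ∪ (B + d) exceeds B by one element, so all elements of B but one have their
    -- predecessor in B.
    progression : ∀ {B d} → d ≢ ε → 1 ≤ card B → card B < n → card (B ∪ shift d B) ≤ suc (card B) → Progression B
    progression {B} {d} d≢ε 1≤B B<n ∪≤ =
      -- The progression starts at an element of B whose predecessor lies outside B.
      let b₀ , b₀∈B , b₀-d∉B = exit {B} {⊖ d} (λ eq → d≢ε (trans (sym (⁻¹-involutive d)) (trans (cong ⊖_ eq) ε⁻¹≈ε))) 1≤B B<n
          log , ·log , log· = discreteLog d≢ε
      in b₀ , d , from-start b₀ b₀∈B b₀-d∉B log ·log log·
      where
      B≤1+∩ : card B ≤ suc (card (B ∩ shift d B))
      B≤1+∩ = ℕ.+-cancelˡ-≤ (card B) (card B) (suc i) (begin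
        card B + card B               ≡⟨ cong (card B +_) (sym (card-shift d B)) ⟩
        card B + card (shift d B)     ≡⟨ sym (card-∪∩ B (shift d B)) ⟩
        card (B ∪ shift d B) + i      ≤⟨ ℕ.+-monoˡ-≤ i ∪≤ ⟩
        suc (card B) + i              ≡⟨ sym (ℕ.+-suc (card B) i) ⟩
        card B + suc i                ∎)
        where
        open ℕ.≤-Reasoning
        i : ℕ
        i = card (B ∩ shift d B)
      -- Two distinct elements of B without predecessor in B would both be missing from B ∩ (B + d),
      -- which omits at most one element of B.
      predecessor : ∀ {b₀ b} → b₀ ∈ B → b₀ ⊝ d ∉ B → b ∈ B → b₀ ≢ b → b ⊝ d ∈ B
      predecessor {b₀} {b} b₀∈B b₀-d∉B b∈B b₀≢b = decidable-stable (b ⊝ d ∈? B) (λ b-d∉B →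
        ℕ.<⇒≱ (subst (suc (card (B ∩ shift d B)) <_) (sym (trans (card-∖ {S = B} b₀∈B) (cong suc (card-∖ {S = B ∖ b₀} (∈∖⁺ {S = B} b∈B b₀≢b)))))
                 (s≤s (s≤s (card-mono {S = B ∩ shift d B} {B ∖ b₀ ∖ b} (λ y∈ → let y∈B , y-d∈B = ∈∩⁻ {S = B} {shift d B} y∈ in
                   ∈∖⁺ {S = B ∖ b₀} (∈∖⁺ {S = B} y∈B (λ { refl → b₀-d∉B (∈shift⁻ {d} {B} y-d∈B) }))
                                    (λ { refl → b-d∉B (∈shift⁻ {d} {B} y-d∈B) }))))))
              B≤1+∩)
      from-start : ∀ b₀ → b₀ ∈ B → b₀ ⊝ d ∉ B → (log : Fin n → Fin n) →
        (∀ y → toℕ (log y) · d ≡ y) → (∀ i → log (toℕ i · d) ≡ i) →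
        ∀ s → s ∈ B ⇔ (∃[ i ] (i < card B × s ≡ b₀ ⊕ (i · d)))
      from-start b₀ b₀∈B b₀-d∉B log ·log log· s = mk⇔
        (λ { s∈B → toℕ (log (s ⊝ b₀)) , subst (toℕ (log (s ⊝ b₀)) <_) card-hit
               (to (hit⇔ (toℕ (log (s ⊝ b₀))) (Fin.toℕ<n _)) (_∈_.holds (∈-resp {B} (sym (unlog s)) s∈B)))
             , sym (unlog s) })
        (λ { (i , i<B , refl) → mem (from (hit⇔ i (ℕ.<-trans i<B B<n)) (subst (i <_) (sym card-hit) i<B)) })
        where
        unlog : ∀ s → b₀ ⊕ (toℕ (log (s ⊝ b₀)) · d) ≡ s
        unlog s = trans (cong (b₀ ⊕_) (·log (s ⊝ b₀))) (trans (comm b₀ (s ⊝ b₀)) (x⊝y⊕y s b₀))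
        hit : ℕ → Bool
        hit i = B (b₀ ⊕ (i · d))
        card-hit : card {n} (λ i → hit (toℕ i)) ≡ card B
        card-hit = card-permute B (λ i → b₀ ⊕ (toℕ i · d)) (λ s → log (s ⊝ b₀)) unlog
          (λ i → trans (cong log (trans (cong (_⊝ b₀) (comm b₀ (toℕ i · d))) (x⊕y⊝y (toℕ i · d) b₀))) (log· i))
        nonzero : ∀ m → suc m < n → suc m · d ≢ ε
        nonzero m m<n eq = ℕ.0≢1+n (trans (sym (Fin.toℕ-fromℕ< 0<n)) (trans (cong toℕ i₀≡i₁) (Fin.toℕ-fromℕ< m<n)))
          where
          0<n : 0 < n
          0<n = ℕ.<-trans (s≤s z≤n) m<n
          i₀≡i₁ : fromℕ< 0<n ≡ fromℕ< m<n
          i₀≡i₁ = trans (sym (log· (fromℕ< 0<n))) (trans (cong log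
            (trans (cong (_· d) (Fin.toℕ-fromℕ< 0<n)) (trans (sym eq) (cong (_· d) (sym (Fin.toℕ-fromℕ< m<n))))))
            (log· (fromℕ< m<n)))
        -- For m + 1 < n the term b₀ + (m + 1) d has not returned to b₀, so it has its predecessor
        -- in B.
        down : ∀ m → suc m < n → T (hit (suc m)) → T (hit m)
        down m m<n t = _∈_.holds (∈-resp {B} (trans (cong (_⊝ d) (trans (cong (b₀ ⊕_) (comm d (m · d))) (sym (assoc b₀ (m · d) d))))
                                                 (x⊕y⊝y (b₀ ⊕ (m · d)) d))
          (predecessor {b₀} {b₀ ⊕ (suc m · d)} b₀∈B b₀-d∉B (mem t)
            (λ eq → nonzero m m<n (∙-cancelˡ b₀ (suc m · d) ε (trans (sym eq) (sym (identityʳ b₀)))))))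
        hit⇔ : ∀ m → m < n → T (hit m) ⇔ m < card {n} (λ i → hit (toℕ i))
        hit⇔ = down-closed n hit down

    -- For a critical set {x₀, x₁} and d = x₁ - x₀, its sumset with B contains the translate of B ∪
    -- (B + d) by x₀, and criticality limits that sumset to |B| + 1 elements.
    vosper : ∀ {X B} → 2 ≤ card B → Critical X B → Progression B
    vosper {X} {B} 2≤B c =
      let X′ , c′ , X′≤2 = critical-pair {X} {B} 2≤B c
          x₀ , x₁ , x₀∈ , x₁∈ , x₀≢x₁ = two-elements {S = X′} (2≤X c′)
      in from-pair X′ c′ X′≤2 x₀ x₁ x₀∈ x₁∈ x₀≢x₁
      where
      from-pair : ∀ X′ → Critical X′ B → card X′ ≤ 2 → ∀ x₀ x₁ → x₀ ∈ X′ → x₁ ∈ X′ → x₀ ≢ x₁ → Progression B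
      from-pair X′ c′ X′≤2 x₀ x₁ x₀∈ x₁∈ x₀≢x₁ =
        progression {B} {d} (λ eq → x₀≢x₁ (sym (x∙y⁻¹≈ε⇒x≈y x₁ x₀ eq))) (ℕ.<⇒≤ 2≤B)
          (ℕ.≤-<-trans (ℕ.≤-trans (card-mono {S = B} {B ∪ shift d B} (∈∪⁺ˡ {S = B})) ∪≤Q) (ℕ.<-trans ℕ.≤-refl (2+≤n c′)))
          (ℕ.≤-trans ∪≤Q (ℕ.≤-pred (ℕ.≤-trans (small c′) (ℕ.+-monoˡ-≤ (card B) X′≤2))))
        where
        d : Fin n
        d = x₁ ⊝ x₀
        sub : shift x₀ (B ∪ shift d B) ⊆ X′ ⊞ B
        sub {s} s∈ = [ (λ s∈B → ∈-resp {X′ ⊞ B} (trans (comm x₀ (s ⊝ x₀)) (x⊝y⊕y s x₀)) (∈⊞⁺ {X′} {B} x₀∈ s∈B))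
                     , (λ s∈d → ∈-resp {X′ ⊞ B} (trans (comm x₁ (s ⊝ x₁)) (x⊝y⊕y s x₁))
                         (∈⊞⁺ {X′} {B} x₁∈ (∈-resp {B} (⊝-chain s x₀ x₁) (∈shift⁻ {d} {B} s∈d)))) ]′
                     (∈∪⁻ {S = B} {shift d B} (∈shift⁻ {x₀} {B ∪ shift d B} s∈))
        ∪≤Q : card (B ∪ shift d B) ≤ card (X′ ⊞ B)
        ∪≤Q = subst (_≤ card (X′ ⊞ B)) (card-shift x₀ (B ∪ shift d B)) (card-mono {S = shift x₀ (B ∪ shift d B)} {X′ ⊞ B} sub)

-- Enumerations of subsets, images and tuples.

toList : ∀ {n} → Subset n → List (Fin n)
toList {zero}  S = []
toList {suc n} S = (if S Fin.zero then Fin.zero ∷ [] else []) List.++ List.map Fin.suc (toList (S ∘ Fin.suc))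

length-toList : ∀ {n} (S : Subset n) → length (toList S) ≡ card S
length-toList {zero}  S = refl
length-toList {suc n} S = trans (List.length-++ (if S Fin.zero then Fin.zero ∷ [] else []))
  (cong₂ _+_ (head (S Fin.zero)) (trans (List.length-map Fin.suc (toList (S ∘ Fin.suc))) (length-toList (S ∘ Fin.suc))))
  where
  head : ∀ b → length {A = Fin (suc n)} (if b then Fin.zero ∷ [] else []) ≡ ind b
  head true  = refl
  head false = refl

∈-toList : ∀ {n} {S : Subset n} {x} → x ∈ S → x ListMembership.∈ toList S
∈-toList {suc n} {S} {Fin.zero}  (mem t) with true ← S Fin.zero = here refl
∈-toList {suc n} {S} {Fin.suc x} (mem t) =
  ListAny.++⁺ʳ (if S Fin.zero then Fin.zero ∷ [] else []) (∈-map⁺ Fin.suc (∈-toList {S = S ∘ Fin.suc} (mem t)))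

card≤length : ∀ {n} (S : Subset n) L → (∀ {x} → x ∈ S → x ListMembership.∈ L) → card S ≤ length L
card≤length S []      S⊆L = ℕ.≤-reflexive (card-empty {S = S} (λ x∈S → ListAny.¬Any[] (S⊆L x∈S)))
card≤length S (y ∷ L) S⊆L = ℕ.≤-trans remove (s≤s (card≤length (S ∖ y) L rest))
  where
  remove : card S ≤ suc (card (S ∖ y))
  remove with y ∈? S
  ... | yes y∈S = ℕ.≤-reflexive (card-∖ y∈S)
  ... | no  y∉S = ℕ.m≤n⇒m≤1+n (card-mono {S = S} {S ∖ y} (λ x∈S → ∈∖⁺ {S = S} x∈S (λ { refl → y∉S x∈S })))
  rest : ∀ {x} → x ∈ S ∖ y → x ListMembership.∈ L
  rest x∈ with S⊆L (∖⊆ {S = S} x∈)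
  ... | here refl = contradiction x∈ (∉∖ {S = S})
  ... | there x∈L = x∈L

image : ∀ {k n} → (Fin k → Fin n) → Subset n
image a = ⟪ (λ s → Fin.any? (λ j → s Fin.≟ a j)) ⟫

module _ {k n} {a : Fin k → Fin n} where

  ∈image⁺ : ∀ j → a j ∈ image a
  ∈image⁺ j = ∈⟪⟫⁺ {P? = λ s → Fin.any? (λ j → s Fin.≟ a j)} (j , refl)

  ∈image⁻ : ∀ {s} → s ∈ image a → ∃[ j ] s ≡ a j
  ∈image⁻ = ∈⟪⟫⁻ {P? = λ s → Fin.any? (λ j → s Fin.≟ a j)}

card-image : ∀ {k n} {a : Fin k → Fin n} → Injective _≡_ _≡_ a → card (image a) ≡ k
card-image {zero}  {a = a} inj = card-empty {S = image a} (λ s∈ → Fin.¬Fin0 (proj₁ (∈image⁻ {a = a} s∈)))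
card-image {suc k} {n} {a} inj = trans (card-∖ {S = image a} (∈image⁺ {a = a} Fin.zero))
  (cong suc (trans (ℕ.≤-antisym (card-mono {S = image a ∖ a Fin.zero} {image a′} sub) (card-mono {S = image a′} {image a ∖ a Fin.zero} sup))
                   (card-image {a = a′} (λ eq → Fin.suc-injective (inj eq)))))
  where
  a′ : Fin k → Fin n
  a′ j = a (Fin.suc j)
  sub : image a ∖ a Fin.zero ⊆ image a′
  sub {s} s∈ with ∈image⁻ {a = a} (∖⊆ {S = image a} s∈)
  ... | Fin.zero  , refl = contradiction s∈ (∉∖ {S = image a})
  ... | Fin.suc j , refl = ∈image⁺ {a = a′} j
  sup : image a′ ⊆ image a ∖ a Fin.zero
  sup s∈ with ∈image⁻ {a = a′} s∈
  ... | j , refl = ∈∖⁺ {S = image a} (∈image⁺ {a = a} (Fin.suc j)) (λ eq → Fin.0≢1+n (inj eq))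

-- Makes membership in r^A decidable, as a subset with Boolean values requires.
anyVec? : ∀ {k} r {P : Vec (Fin k) r → Set} → (∀ v → Dec (P v)) → Dec (∃ P)
anyVec? zero    P? = map′ ([] ,_) (λ { ([] , p) → p }) (P? [])
anyVec? (suc r) P? = map′ (λ { (j , v , p) → j ∷ v , p }) (λ { (j ∷ v , p) → j , v , p })
                       (Fin.any? (λ j → anyVec? r (λ v → P? (j ∷ v))))

-- Sums and supports of multiplicity functions.

Σᶠ-update : ∀ k {f g : Fin k → ℕ} j c → f j ≡ c + g j → (∀ i → i ≢ j → f i ≡ g i) → Σᶠ k f ≡ c + Σᶠ k g
Σᶠ-cong : ∀ k {f g : Fin k → ℕ} → (∀ i → f i ≡ g i) → Σᶠ k f ≡ Σᶠ k g
Σᶠ-cong zero    eq = refl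
Σᶠ-cong (suc k) eq = cong₂ _+_ (eq Fin.zero) (Σᶠ-cong k (λ i → eq (Fin.suc i)))

Σᶠ-update (suc k) {f} {g} Fin.zero c at off =
  trans (cong₂ _+_ at (Σᶠ-cong k (λ i → off (Fin.suc i) (λ ())))) (ℕ.+-assoc c (g Fin.zero) _)
Σᶠ-update (suc k) {f} {g} (Fin.suc j) c at off =
  trans (cong₂ _+_ (off Fin.zero (λ ())) (Σᶠ-update k j c at (λ i i≢j → off (Fin.suc i) (λ eq → i≢j (Fin.suc-injective eq)))))
        (lem (g Fin.zero) c (Σᶠ k (g ∘ Fin.suc)))
  where
  lem : ∀ a c s → a + (c + s) ≡ c + (a + s)
  lem = solve-∀

Σᶠ-zero : ∀ k → Σᶠ k (λ _ → 0) ≡ 0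
Σᶠ-zero zero    = refl
Σᶠ-zero (suc k) = Σᶠ-zero k

supp-mono : ∀ k {x y : Fin k → ℕ} → (∀ i → x i ≤ y i) → supp k x ≤ supp k y
supp-mono zero    le = z≤n
supp-mono (suc k) {x} {y} le with x Fin.zero | y Fin.zero | le Fin.zero
... | zero  | zero  | _ = supp-mono k (λ i → le (Fin.suc i))
... | zero  | suc _ | _ = ℕ.m≤n⇒m≤1+n (supp-mono k (λ i → le (Fin.suc i)))
... | suc _ | suc _ | _ = s≤s (supp-mono k (λ i → le (Fin.suc i)))

supp-new : ∀ k {x y : Fin k → ℕ} j → x j ≡ 0 → 1 ≤ y j → (∀ i → x i ≤ y i) → suc (supp k x) ≤ supp k y
supp-new (suc k) {x} {y} Fin.zero x≡0 1≤y le with x Fin.zero | y Fin.zero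
supp-new (suc k) {x} {y} Fin.zero refl 1≤y le | _ | suc _ = s≤s (supp-mono k (λ i → le (Fin.suc i)))
supp-new (suc k) {x} {y} (Fin.suc j) x≡0 1≤y le with x Fin.zero | y Fin.zero | le Fin.zero
... | zero  | zero  | _ = supp-new k j x≡0 1≤y (λ i → le (Fin.suc i))
... | zero  | suc _ | _ = ℕ.m≤n⇒m≤1+n (supp-new k j x≡0 1≤y (λ i → le (Fin.suc i)))
... | suc _ | suc _ | _ = s≤s (supp-new k j x≡0 1≤y (λ i → le (Fin.suc i)))

inc : ∀ {k} → Fin k → (Fin k → ℕ) → Fin k → ℕ
inc j x i with i Fin.≟ j
... | yes _ = suc (x i)
... | no  _ = x i

inc-at : ∀ {k} (j : Fin k) x → inc j x j ≡ suc (x j)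
inc-at j x with j Fin.≟ j
... | yes _  = refl
... | no j≢j = contradiction refl j≢j

inc-off : ∀ {k} (j : Fin k) x i → i ≢ j → inc j x i ≡ x i
inc-off j x i i≢j with i Fin.≟ j
... | yes i≡j = contradiction i≡j i≢j
... | no  _   = refl

inc-≥ : ∀ {k} (j : Fin k) x i → x i ≤ inc j x i
inc-≥ j x i with i Fin.≟ j
... | yes _ = ℕ.n≤1+n (x i)
... | no  _ = ℕ.≤-refl

Σᶠ-inc : ∀ {k} (j : Fin k) x → Σᶠ k (inc j x) ≡ suc (Σᶠ k x)
Σᶠ-inc {k} j x = Σᶠ-update k j 1 (inc-at j x) (inc-off j x)

Σᶠ-inc-* : ∀ {k} (j : Fin k) x (w : Fin k → ℕ) → Σᶠ k (λ i → inc j x i * w i) ≡ w j + Σᶠ k (λ i → x i * w i)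
Σᶠ-inc-* {k} j x w = Σᶠ-update k j (w j) (cong (_* w j) (inc-at j x)) (λ i i≢j → cong (_* w i) (inc-off j x i i≢j))

2*triangle : ∀ r → 2 * triangle r ≡ r * (r ∸ 1)
2*triangle zero          = refl
2*triangle (suc zero)    = refl
2*triangle (suc (suc r)) = trans (lem r (triangle (suc r))) (trans (cong (λ t → 2 * suc r + t) (2*triangle (suc r))) (lem′ r))
  where
  lem : ∀ r t → 2 * (suc r + t) ≡ 2 * suc r + 2 * t
  lem r t = ℕ.*-distribˡ-+ 2 (suc r) t
  lem′ : ∀ r → 2 * (1 + r) + (1 + r) * r ≡ (2 + r) * (1 + r)
  lem′ = solve-∀

-- The group of residues modulo p.

module Residues (p : ℕ) (pr : Prime p) where

  open import Data.Integer using (+_)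

  instance
    p≢0 : NonZero p
    p≢0 = prime⇒nonZero pr

  toℕ-mod : ∀ m → toℕ (m mod p) ≡ m % p
  toℕ-mod m = Fin.toℕ-fromℕ< (m%n<n m p)

  mod-cong : ∀ {m n} → m % p ≡ n % p → m mod p ≡ n mod p
  mod-cong {m} {n} eq = Fin.toℕ-injective (trans (toℕ-mod m) (trans eq (sym (toℕ-mod n))))

  mod-toℕ : ∀ (x : Fin p) → toℕ x mod p ≡ x
  mod-toℕ x = Fin.toℕ-injective (trans (toℕ-mod (toℕ x)) (m<n⇒m%n≡m (Fin.toℕ<n x)))

  +-%ˡ : ∀ m n → (m % p + n) % p ≡ (m + n) % p
  +-%ˡ m n = trans (%-distribˡ-+ (m % p) n p)
    (trans (cong (λ z → (z + n % p) % p) (m%n%n≡m%n m p)) (sym (%-distribˡ-+ m n p)))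

  *-%ˡ : ∀ m n → (m % p * n) % p ≡ (m * n) % p
  *-%ˡ m n = trans (%-distribˡ-* (m % p) n p)
    (trans (cong (λ z → (z * (n % p)) % p) (m%n%n≡m%n m p)) (sym (%-distribˡ-* m n p)))

  +-modˡ : ∀ m n → (toℕ (m mod p) + n) mod p ≡ (m + n) mod p
  +-modˡ m n = mod-cong (trans (cong (λ z → (z + n) % p) (toℕ-mod m)) (+-%ˡ m n))

  +-modʳ : ∀ m n → (m + toℕ (n mod p)) mod p ≡ (m + n) mod p
  +-modʳ m n = trans (cong (_mod p) (ℕ.+-comm m _)) (trans (+-modˡ n m) (cong (_mod p) (ℕ.+-comm n m)))

  *-modˡ : ∀ m n → (toℕ (m mod p) * n) mod p ≡ (m * n) mod p
  *-modˡ m n = mod-cong (trans (cong (λ z → (z * n) % p) (toℕ-mod m)) (*-%ˡ m n))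

  infixl 6 _⊕_
  _⊕_ : Fin p → Fin p → Fin p
  x ⊕ y = (toℕ x + toℕ y) mod p

  ⊖_ : Fin p → Fin p
  ⊖ x = (p ∸ toℕ x) mod p

  ε : Fin p
  ε = 0 mod p

  ⊕-comm : ∀ x y → x ⊕ y ≡ y ⊕ x
  ⊕-comm x y = cong (_mod p) (ℕ.+-comm (toℕ x) (toℕ y))

  ⊕-assoc : ∀ x y z → (x ⊕ y) ⊕ z ≡ x ⊕ (y ⊕ z)
  ⊕-assoc x y z = trans (+-modˡ (toℕ x + toℕ y) (toℕ z))
    (trans (cong (_mod p) (ℕ.+-assoc (toℕ x) (toℕ y) (toℕ z))) (sym (+-modʳ (toℕ x) (toℕ y + toℕ z))))

  ⊕-identityˡ : ∀ x → ε ⊕ x ≡ x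
  ⊕-identityˡ x = trans (+-modˡ 0 (toℕ x)) (mod-toℕ x)

  ⊕-inverseʳ : ∀ x → x ⊕ (⊖ x) ≡ ε
  ⊕-inverseʳ x = trans (+-modʳ (toℕ x) (p ∸ toℕ x))
    (mod-cong (trans (cong (_% p) (ℕ.m+[n∸m]≡n (ℕ.<⇒≤ (Fin.toℕ<n x)))) (trans (n%n≡0 p) (sym (m<n⇒m%n≡m (ℕ.n≢0⇒n>0 (ℕ.≢-nonZero⁻¹ p)))))))

  ⊕-isAbelianGroup : IsAbelianGroup _≡_ _⊕_ ε ⊖_
  ⊕-isAbelianGroup = record
    { isGroup = record
      { isMonoid = record
        { isSemigroup = record
          { isMagma = record { isEquivalence = isEquivalence ; ∙-cong = cong₂ _⊕_ }
          ; assoc = ⊕-assoc }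
        ; identity = ⊕-identityˡ , λ x → trans (⊕-comm x ε) (⊕-identityˡ x) }
      ; inverse = (λ x → trans (⊕-comm (⊖ x) x) (⊕-inverseʳ x)) , ⊕-inverseʳ
      ; ⁻¹-cong = cong ⊖_ }
    ; comm = ⊕-comm }

  module ℤₚ = Sumsets ⊕-isAbelianGroup
  open ℤₚ using (_·_; _⊞_; critical; Progression)

  ·-mod : ∀ m d → m · d ≡ (m * toℕ d) mod p
  ·-mod zero    d = refl
  ·-mod (suc m) d = trans (cong (d ⊕_) (·-mod m d)) (+-modʳ (toℕ d) (m * toℕ d))

  inverse-mod : ∀ d → 0 < d → d < p → ∃[ e ] (d * e) % p ≡ 1 % p
  inverse-mod d 0<d d<p with coprime-Bézout (prime⇒coprime pr {{ℕ.>-nonZero 0<d}} d<p)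
  ... | Bézout.-+ x y eq = y , trans (cong (_% p) (trans (ℕ.*-comm d y) (sym eq))) ([m+kn]%n≡m%n 1 x p)
  -- Here 1 + y d = x p, so y inverts -d; the factor q = p - 1, which is -1 modulo p, corrects the
  -- sign.
  ... | Bézout.+- x y eq = y * q , (begin
      (d * (y * q)) % p            ≡⟨ sym ([m+n]%n≡m%n (d * (y * q)) p) ⟩
      (d * (y * q) + p) % p        ≡⟨ cong (λ z → (d * (y * q) + z) % p) (sym 1+q) ⟩
      (d * (y * q) + suc q) % p    ≡⟨ cong (_% p) (lem₁ d y q) ⟩
      (1 + q * (1 + y * d)) % p    ≡⟨ cong (λ z → (1 + q * z) % p) eq ⟩
      (1 + q * (x * p)) % p        ≡⟨ cong (λ z → (1 + z) % p) (sym (ℕ.*-assoc q x p)) ⟩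
      (1 + q * x * p) % p          ≡⟨ [m+kn]%n≡m%n 1 (q * x) p ⟩
      1 % p                        ∎)
    where
    open ≡-Reasoning
    q : ℕ
    q = p ∸ 1
    1+q : suc q ≡ p
    1+q = ℕ.m+[n∸m]≡n (ℕ.<-≤-trans 0<d (ℕ.<⇒≤ d<p))
    lem₁ : ∀ d y q → d * (y * q) + (1 + q) ≡ 1 + q * (1 + y * d)
    lem₁ = solve-∀

  -- Division by d: the logarithm of y is y times an inverse of d modulo p.
  discreteLog : ∀ {d} → d ≢ ε → ∃ λ (log : Fin p → Fin p) → (∀ y → toℕ (log y) · d ≡ y) × (∀ i → log (toℕ i · d) ≡ i)
  discreteLog {d} d≢ε = (λ y → (toℕ y * e) mod p)
    , (λ y → trans (·-mod (toℕ ((toℕ y * e) mod p)) d) (trans (*-modˡ (toℕ y * e) (toℕ d)) (unit y (trans (ℕ.*-assoc (toℕ y) e (toℕ d)) (cong (toℕ y *_) (ℕ.*-comm e (toℕ d)))))))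
    , (λ i → trans (cong (λ z → (toℕ z * e) mod p) (·-mod (toℕ i) d)) (trans (*-modˡ (toℕ i * toℕ d) e) (unit i (ℕ.*-assoc (toℕ i) (toℕ d) e))))
    where
    0<d : 0 < toℕ d
    0<d = ℕ.n≢0⇒n>0 (λ eq → d≢ε (trans (sym (mod-toℕ d)) (cong (_mod p) eq)))
    e : ℕ
    e = proj₁ (inverse-mod (toℕ d) 0<d (Fin.toℕ<n d))
    unit : ∀ (x : Fin p) {m} → m ≡ toℕ x * (toℕ d * e) → m mod p ≡ x
    unit x {m} eq = trans (mod-cong (begin
      m % p                          ≡⟨ cong (_% p) (trans eq (ℕ.*-comm (toℕ x) (toℕ d * e))) ⟩
      (toℕ d * e * toℕ x) % p        ≡⟨ sym (*-%ˡ (toℕ d * e) (toℕ x)) ⟩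
      ((toℕ d * e) % p * toℕ x) % p  ≡⟨ cong (λ z → (z * toℕ x) % p) (proj₂ (inverse-mod (toℕ d) 0<d (Fin.toℕ<n d))) ⟩
      (1 % p * toℕ x) % p            ≡⟨ *-%ˡ 1 (toℕ x) ⟩
      (1 * toℕ x) % p                ≡⟨ cong (_% p) (ℕ.*-identityˡ (toℕ x)) ⟩
      toℕ x % p                      ∎)) (mod-toℕ x)
      where open ≡-Reasoning

  ∣ℤ-remainder : ∀ m → + p ∣ℤ + m ℤ.- + (m % p)
  ∣ℤ-remainder m = ℤ∣.divides (+ (m / p)) (begin
    + m ℤ.- + (m % p)                               ≡⟨ cong (λ z → + z ℤ.- + (m % p)) (m≡m%n+[m/n]*n m p) ⟩
    + (m % p) ℤ.+ + (m / p * p) ℤ.- + (m % p)       ≡⟨ lem (+ (m % p)) (+ (m / p * p)) ⟩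
    + (m / p * p)                                   ≡⟨ ℤ.pos-* (m / p) p ⟩
    + (m / p) ℤ.* + p                               ∎)
    where
    open ≡-Reasoning
    lem : ∀ a b → a ℤ.+ b ℤ.- a ≡ b
    lem = ℤ-Solver.solve-∀

  difference-∤ : ∀ {x y : Fin p} → toℕ x < toℕ y → ¬ + p ∣ℤ + toℕ y ℤ.- + toℕ x
  difference-∤ {x} {y} x<y dv = small-∤ (ℕ.m<n⇒0<n∸m x<y) (ℕ.≤-<-trans (ℕ.m∸n≤m (toℕ y) (toℕ x)) (Fin.toℕ<n y))
    (subst (+ p ∣ℤ_) (trans (ℤ.m-n≡m⊖n (toℕ y) (toℕ x)) (ℤ.⊖-≥ (ℕ.<⇒≤ x<y))) dv)

  distinct-∤ : ∀ {x y : Fin p} → x ≢ y → ¬ + p ∣ℤ + toℕ x ℤ.- + toℕ y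
  distinct-∤ {x} {y} x≢y dv with ℕ.<-cmp (toℕ x) (toℕ y)
  ... | tri< x<y _ _ = difference-∤ {x} {y} x<y (subst (+ p ∣ℤ_) (lem (+ toℕ x) (+ toℕ y)) (ℤ∣.∣m⇒∣-m dv))
    where
    lem : ∀ a b → ℤ.- (a ℤ.- b) ≡ b ℤ.- a
    lem = ℤ-Solver.solve-∀
  ... | tri≈ _ x≡y _ = x≢y (Fin.toℕ-injective x≡y)
  ... | tri> _ _ y<x = difference-∤ {y} {x} y<x dv

  -- Sums of r distinct elements and the inverse theorem.

  module Restricted {K : ℕ} (a : Fin (suc K) → Fin p) (a-inj : Injective _≡_ _≡_ a) (r : ℕ) where

    k : ℕ
    k = suc K

    total : ∀ {r} → Vec (Fin k) r → ℕ
    total []       = 0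
    total (j ∷ js) = toℕ (a j) + total js

    distinctSum? : ∀ s → Dec (∃ λ (js : Vec (Fin k) r) → Unique js × s ≡ total js mod p)
    distinctSum? s = anyVec? r (λ js → AllPairs.allPairs? (λ i j → ¬? (i Fin.≟ j)) js ×-dec (s Fin.≟ total js mod p))

    A : Subset p
    A = image a

    -- r^A + jA
    sums : ℕ → Subset p
    sums zero    = ⟪ distinctSum? ⟫
    sums (suc j) = sums j ⊞ A

    -- Out-of-range indices are sent to zero.
    extend : ℕ → Fin k
    extend n with n ℕ.<? k
    ... | yes n<k = fromℕ< n<k
    ... | no  _   = Fin.zero

    toℕ-extend : ∀ {n} → n < k → toℕ (extend n) ≡ n
    toℕ-extend {n} n<k with n ℕ.<? k
    ... | yes n<k′ = Fin.toℕ-fromℕ< n<k′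
    ... | no  n≮k  = contradiction n<k n≮k

    â : ℕ → ℤ
    â n = + toℕ (a (extend n))

    â-distinct : ∀ {i j} → i < j → j < k → ¬ + p ∣ℤ â j ℤ.- â i
    â-distinct i<j j<k = distinct-∤ (λ eq → ℕ.<⇒≢ i<j (sym
      (trans (sym (toℕ-extend j<k)) (trans (cong toℕ (a-inj eq)) (toℕ-extend (ℕ.<-trans i<j j<k))))))

    open Evaluation K â using (asum; sum-cover-length)

    asum≡total : ∀ {r} (js : Vec ℕ r) → asum js ≡ + total (Vec.map extend js)
    asum≡total []       = refl
    asum≡total (j ∷ js) = cong (λ z → + toℕ (a (extend j)) ℤ.+ z) (asum≡total js)

    extend-∉ : ∀ {r n} {js : Vec ℕ r} → n < k → All (_< k) js → All (n ≢_) js → All (extend n ≢_) (Vec.map extend js)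
    extend-∉ n<k []            []          = []
    extend-∉ n<k (m<k ∷ js<k) (n≢m ∷ n∉js) =
      (λ eq → n≢m (trans (sym (toℕ-extend n<k)) (trans (cong toℕ eq) (toℕ-extend m<k)))) ∷ extend-∉ n<k js<k n∉js

    extend-unique : ∀ {r} {js : Vec ℕ r} → All (_< k) js → Unique js → Unique (Vec.map extend js)
    extend-unique []           []             = []
    extend-unique (n<k ∷ js<k) (n∉js ∷ uniq) = extend-∉ n<k js<k n∉js ∷ extend-unique js<k uniq

    -- `weight` says M = r(k - r). The representatives of the elements of `sums 0` serve as the
    -- covering list, since every sum of r distinct elements of A is congruent to one of them.
    card-distinctSums : ∀ {M} → r * K ≡ M + 2 * triangle r → r ≤ k → M < p → M < card (sums 0)
    card-distinctSums {M} weight r≤k M<p = subst (M <_)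
      (trans (List.length-map (λ s → + toℕ s) (toList (sums 0))) (length-toList (sums 0)))
      (sum-cover-length pr â-distinct weight r≤k M<p (List.map (λ s → + toℕ s) (toList (sums 0))) cover)
      where
      cover : ∀ (js : Vec ℕ r) → All (_< k) js → Unique js →
              ListAny.Any (λ c → + p ∣ℤ asum js ℤ.- c) (List.map (λ s → + toℕ s) (toList (sums 0)))
      cover js js<k uniq = ListAny.map (λ { refl → divides })
        (∈-map⁺ (λ s → + toℕ s) (∈-toList {S = sums 0} (∈⟪⟫⁺ {P? = distinctSum?} (js′ , extend-unique js<k uniq , refl))))
        where
        js′ : Vec (Fin k) r
        js′ = Vec.map extend js
        divides : + p ∣ℤ asum js ℤ.- + toℕ (total js′ mod p)
        divides = subst (+ p ∣ℤ_) (sym (cong₂ (λ x y → x ℤ.- + y) (asum≡total js) (toℕ-mod (total js′)))) (∣ℤ-remainder (total js′))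

    -- By Cauchy-Davenport every further summand A adds at least k - 1 elements as long as the
    -- sumset is not all of the group.
    card-sums : ∀ {M} → r * K ≡ M + 2 * triangle r → r ≤ k → M < p →
                ∀ j → card (sums j) < p → M + j * K < card (sums j)
    card-sums {M} weight r≤k M<p zero    <p = subst (_< card (sums 0)) (sym (ℕ.+-identityʳ M)) (card-distinctSums weight r≤k M<p)
    card-sums {M} weight r≤k M<p (suc j) <p = ℕ.≤-pred (begin
      2 + (M + (K + j * K))          ≡⟨ lem M K (j * K) ⟩
      suc (M + j * K) + suc K        ≤⟨ ℕ.+-mono-≤ IH (ℕ.≤-reflexive (sym card-A)) ⟩
      card (sums j) + card A         ≤⟨ ℤₚ.cauchy-davenport discreteLog {sums j} {A} (ℕ.≤-trans (s≤s z≤n) IH) 1≤A <p ⟩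
      suc (card (sums (suc j)))      ∎)
      where
      open ℕ.≤-Reasoning
      card-A : card A ≡ k
      card-A = card-image a-inj
      1≤A : 1 ≤ card A
      1≤A = ℕ.≤-trans (s≤s z≤n) (ℕ.≤-reflexive (sym card-A))
      IH : M + j * K < card (sums j)
      IH = card-sums weight r≤k M<p j (ℕ.≤-<-trans (ℤₚ.card≤⊞ {sums j} {A} 1≤A) <p)
      lem : ∀ M K t → 2 + (M + (K + t)) ≡ 1 + (M + t) + (1 + K)
      lem = solve-∀

    count : ∀ {r} → Vec (Fin k) r → Fin k → ℕ
    count []       = λ _ → 0
    count (j ∷ js) = inc j (count js)

    Σᶠ-count : ∀ {r} (js : Vec (Fin k) r) → Σᶠ k (count js) ≡ r
    Σᶠ-count []       = Σᶠ-zero k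
    Σᶠ-count (j ∷ js) = trans (Σᶠ-inc j (count js)) (cong suc (Σᶠ-count js))

    Σᶠ-count-total : ∀ {r} (js : Vec (Fin k) r) → Σᶠ k (λ i → count js i * toℕ (a i)) ≡ total js
    Σᶠ-count-total []       = Σᶠ-zero k
    Σᶠ-count-total (j ∷ js) = trans (Σᶠ-inc-* j (count js) (λ i → toℕ (a i))) (cong (λ t → toℕ (a j) + t) (Σᶠ-count-total js))

    count-∉ : ∀ {r j} {js : Vec (Fin k) r} → All (j ≢_) js → count js j ≡ 0
    count-∉ []            = refl
    count-∉ {j = j} {i ∷ js} (j≢i ∷ j∉js) = trans (inc-off i (count js) j j≢i) (count-∉ j∉js)

    supp-count : ∀ {r} {js : Vec (Fin k) r} → Unique js → r ≤ supp k (count js)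
    supp-count []                          = z≤n
    supp-count {js = j ∷ js} (j∉js ∷ uniq) = ℕ.≤-trans (s≤s (supp-count uniq))
      (supp-new k j (count-∉ j∉js) (ℕ.≤-trans (s≤s z≤n) (ℕ.≤-reflexive (sym (inc-at j (count js))))) (inc-≥ j (count js)))

    -- The r distinct indices start with multiplicity one, and each further summand raises one
    -- multiplicity, so the support never falls below r. This bounds the size of r^A + jA by the
    -- given cardinality.
    sums⊆ : ∀ j {s} → s ∈ sums j → InRestrictedSumset p k a (r + j) r s
    sums⊆ zero s∈ with js , uniq , refl ← ∈⟪⟫⁻ {P? = distinctSum?} s∈ =
      count js , trans (Σᶠ-count js) (sym (ℕ.+-identityʳ r)) , supp-count uniq
      , trans (toℕ-mod (total js)) (cong (_% p) (sym (Σᶠ-count-total js)))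
    sums⊆ (suc j) s∈ with y , b , y∈ , b∈A , refl ← ℤₚ.∈⊞⁻ {sums j} {A} s∈ with i , refl ← ∈image⁻ {a = a} b∈A
      with x , Σx≡ , supp≥ , y≡ ← sums⊆ j y∈ =
      inc i x , trans (Σᶠ-inc i x) (trans (cong suc Σx≡) (sym (ℕ.+-suc r j)))
      , ℕ.≤-trans supp≥ (supp-mono k (inc-≥ i x))
      , (begin
        toℕ (y ⊕ a i)                                              ≡⟨ toℕ-mod (toℕ y + toℕ (a i)) ⟩
        (toℕ y + toℕ (a i)) % p                                    ≡⟨ cong (λ z → (z + toℕ (a i)) % p) y≡ ⟩
        (Σᶠ k (λ l → x l * toℕ (a l)) % p + toℕ (a i)) % p         ≡⟨ +-%ˡ (Σᶠ k (λ l → x l * toℕ (a l))) (toℕ (a i)) ⟩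
        (Σᶠ k (λ l → x l * toℕ (a l)) + toℕ (a i)) % p             ≡⟨ cong (_% p) (ℕ.+-comm (Σᶠ k (λ l → x l * toℕ (a l))) (toℕ (a i))) ⟩
        (toℕ (a i) + Σᶠ k (λ l → x l * toℕ (a l))) % p             ≡⟨ cong (_% p) (sym (Σᶠ-inc-* i x (λ l → toℕ (a l)))) ⟩
        Σᶠ k (λ l → inc i x l * toℕ (a l)) % p                     ∎)
      where open ≡-Reasoning

    progression⇒IsAP : Progression discreteLog A → IsAP p k a
    progression⇒IsAP (b , d , iff) = toℕ b , toℕ d , λ s → mk⇔
      (λ { (j , refl) → let i , i<A , s≡ = to (iff (a j)) (∈image⁺ {a = a} j) in
           i , subst (i <_) card-A i<A , trans (cong toℕ s≡) (toℕ-term i) })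
      (λ { (i , i<k , s≡) → ∈image⁻ {a = a} (from (iff s)
           (i , subst (i <_) (sym card-A) i<k , Fin.toℕ-injective (trans s≡ (sym (toℕ-term i))))) })
      where
      card-A : card A ≡ k
      card-A = card-image a-inj
      toℕ-term : ∀ i → toℕ (b ⊕ (i · d)) ≡ (toℕ b + i * toℕ d) % p
      toℕ-term i = trans (cong toℕ (trans (cong (b ⊕_) (·-mod i d)) (+-modʳ (toℕ b) (i * toℕ d)))) (toℕ-mod (toℕ b + i * toℕ d))

    -- Here h = r + j + 2 and the critical pair consists of X = `sums (suc j)` and A, so that X ⊞ A
    -- is `sums (suc (suc j))`. The lower bound on |X| is exactly what places the prescribed
    -- cardinality below |X| + |A|.
    inverse-theorem : 1 ≤ K → r ≤ k → ∀ j → HasCard (InRestrictedSumset p k a (r + suc (suc j)) r) ((r + suc (suc j)) * K ∸ r * (r ∸ 1) + 1) →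
      (r + suc (suc j)) * K ∸ r * (r ∸ 1) + 1 ≤ p ∸ 2 → IsAP p k a
    inverse-theorem 1≤K r≤k j (L , _ , length-L , L⇔) N≤p-2 = progression⇒IsAP
      (ℤₚ.vosper discreteLog {sums (suc j)} {A} (subst (2 ≤_) (sym card-A) (s≤s 1≤K)) (critical
        (ℕ.≤-trans (s≤s (ℕ.≤-trans 1≤K (ℕ.≤-trans (ℕ.m≤m+n K (j * K)) (ℕ.m≤n+m (K + j * K) M)))) X≥)
        2+Q≤p
        (begin
          suc Q                                      ≤⟨ s≤s Q≤N ⟩
          suc ((r + suc (suc j)) * K ∸ r * (r ∸ 1) + 1) ≡⟨ cong (λ z → suc (z + 1)) N≡ ⟩
          suc (M + suc (suc j) * K + 1)              ≡⟨ lem M K j ⟩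
          suc (M + suc j * K) + suc K                ≤⟨ ℕ.+-mono-≤ X≥ (ℕ.≤-reflexive (sym card-A)) ⟩
          card (sums (suc j)) + card A               ∎)))
      where
      open ℕ.≤-Reasoning
      M Q : ℕ
      M = r * K ∸ r * (r ∸ 1)
      Q = card (sums (suc (suc j)))
      card-A : card A ≡ k
      card-A = card-image a-inj
      -- r - 1 ≤ k - 1 makes the truncated subtraction in M exact.
      weight : r * K ≡ M + r * (r ∸ 1)
      weight = sym (ℕ.m∸n+n≡m (ℕ.*-monoʳ-≤ r (ℕ.∸-monoˡ-≤ 1 r≤k)))
      lem : ∀ M K j → 1 + (M + (2 + j) * K + 1) ≡ 1 + (M + (1 + j) * K) + (1 + K)
      lem = solve-∀
      N≡ : (r + suc (suc j)) * K ∸ r * (r ∸ 1) ≡ M + suc (suc j) * K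
      N≡ = trans (cong (_∸ r * (r ∸ 1)) (trans (ℕ.*-distribʳ-+ K r (suc (suc j)))
                   (trans (cong (_+ suc (suc j) * K) weight) (lem₁ M (r * (r ∸ 1)) (suc (suc j) * K)))))
                 (ℕ.m+n∸n≡m (M + suc (suc j) * K) (r * (r ∸ 1)))
        where
        lem₁ : ∀ M t u → M + t + u ≡ M + u + t
        lem₁ = solve-∀
      Q≤N : Q ≤ (r + suc (suc j)) * K ∸ r * (r ∸ 1) + 1
      Q≤N = subst (Q ≤_) length-L (card≤length (sums (suc (suc j))) L (λ {s} s∈ → from (L⇔ s) (sums⊆ (suc (suc j)) s∈)))
      -- A prime is at least 2, so `p ∸ 2` is a true difference.
      2+Q≤p : 2 + Q ≤ p
      2+Q≤p = subst (2 + Q ≤_) (ℕ.m+[n∸m]≡n (ℕ.nonTrivial⇒n>1 p {{prime⇒nonTrivial pr}})) (ℕ.+-monoʳ-≤ 2 (ℕ.≤-trans Q≤N N≤p-2))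
      M<p : M < p
      M<p = ℕ.≤-<-trans (ℕ.≤-trans (ℕ.m≤m+n M (suc (suc j) * K + 1))
              (subst (_≤ p ∸ 2) (trans (cong (_+ 1) N≡) (ℕ.+-assoc M (suc (suc j) * K) 1)) N≤p-2))
              (ℕ.≤-trans (s≤s (ℕ.m≤n+m (p ∸ 2) 1)) (ℕ.≤-reflexive (ℕ.m+[n∸m]≡n (ℕ.nonTrivial⇒n>1 p {{prime⇒nonTrivial pr}}))))
      X≥ : M + suc j * K < card (sums (suc j))
      X≥ = card-sums (trans weight (cong (λ t → M + t) (sym (2*triangle r)))) r≤k M<p (suc j)
             (ℕ.≤-<-trans (ℤₚ.card≤⊞ {sums (suc j)} {A} (ℕ.≤-trans (s≤s z≤n) (ℕ.≤-reflexive (sym card-A)))) (ℕ.≤-trans (ℕ.n≤1+n (suc Q)) 2+Q≤p))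

theorem3p4 : (p : ℕ) (pr : Prime p) (k r h : ℕ) (a : Fin k → Fin p)
    → k ≥ 2 → 1 ≤ r → r ≤ k → h ≥ r + 2
    → Injective _≡_ _≡_ a
    → HasCard (InRestrictedSumset p {{prime⇒nonZero pr}} k a h r) (h * (k ∸ 1) ∸ r * (r ∸ 1) + 1)
    → h * (k ∸ 1) ∸ r * (r ∸ 1) + 1 ≤ p ∸ 2
    → IsAP p {{prime⇒nonZero pr}} k a
-- Writing h = (r + 2) + j leaves j + 2 summands beyond the r distinct ones: j + 1 of them enter X,
-- and the last one is the A of the critical pair.
theorem3p4 p pr (suc K) r h a (s≤s 1≤K) _ r≤k h≥r+2 a-inj with j , refl ← ℕ.m≤n⇒∃[o]m+o≡n h≥r+2
  rewrite ℕ.+-assoc r 2 j = Residues.Restricted.inverse-theorem p pr a a-inj r 1≤K r≤k j
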